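{- Let $T_1$ and $T_2$ be trees with orders $m$ and $n$ and diameters $d_1$ and $d_2$, let $G=T_1\Box T_2$, $p=mn$, $d=d_1+d_2$. Then ${\rm rn}(G)$ equals $$ \begin{cases} (p-1)(d+1)-2nL(T_1)-2mL(T_2)+1, & \text{if } |W(T_1)|=|W(T_2)|=1,\\ (p-1)d-2nL(T_1)-2mL(T_2), & \text{if } |W(T_1)|\cdot|W(T_2)|=2,\\ (p-1)(d-1)-2nL(T_1)-2mL(T_2)+1, & \text{if } |W(T_1)|=|W(T_2)|=2, \end{cases} $$ if and only if there exists a feasible ordering $(z_0,\ldots,z_{p-1})$ of $V(G)$ such that: (a) $L(z_0)+L(z_{p-1})=1$ when $|W(G)|=1$, and $L(z_0)+L(z_{p-1})=0$ when $|W(G)|\ge 2$; (b) for all $0\le a<b\le p-1$, $$ d(z_a,z_b)\geq \sum_{t=a}^{b-1}\big[L(z_t)+L(z_{t+1})+\delta(z_t,z_{t+1})\big]-(b-a-1)(d+1).$$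
   Context: All graphs are finite, simple and connected; $d(u,v)$ is the distance and ${\rm diam}(G)$ the diameter. A radio labeling of $G$ is a map $f:V(G)\to\mathbb{Z}_{\ge 0}$ with $|f(u)-f(v)|\geq {\rm diam}(G)+1-d(u,v)$ for all distinct $u,v$; its span is $\max f-\min f$, and ${\rm rn}(G)$ is the minimum span. For a graph $H$ and $v\in V(H)$, $w_H(v)=\sum_{u\in V(H)}d(u,v)$; weight centers minimize $w_H$, and $W(H)$ is their set. A tree $T$ has one or two weight centers, adjacent if two. The level is $L_T(u)=\min_{w\in W(T)}d(u,w)$ and $L(T)=\sum_u L_T(u)$. Root $T$ at its weight center(s): $u$ is an ancestor of $v$ if the unique path from $v$ to its nearest weight center passes through $u$ (every vertex is its own ancestor). $\phi_T(u,v)=\max\{L_T(z): z$ a common ancestor of $u,v\}$ (0 if none). $\delta_T(u,v)=1$ if $W(T)=\{w,w'\}$ and $u,v$ lie in different components of $T-ww'$, else $0$. For $G=T_1\Box T_2$ and $z=(x,y)$: $L(z)=L_{T_1}(x)+L_{T_2}(y)$, $\phi(z_a,z_b)=\phi_{T_1}(x_a,x_b)+\phi_{T_2}(y_a,y_b)$, $\delta(z_a,z_b)=\delta_{T_1}(x_a,x_b)+\delta_{T_2}(y_a,y_b)$. $W(G)=W(T_1)\times W(T_2)$. Let $\xi=|W(T_1)|+|W(T_2)|-2$. Vertices $z_a,z_b$ are feasible if $\phi(z_a,z_b)=0$ and $\delta(z_a,z_b)=\xi$ (different/opposite/separate sectors when $|W(G)|=1/2/4$), non-feasible otherwise. An ordering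 $(z_0,\ldots,z_{p-1})$ of $V(G)$ is feasible if $z_t,z_{t+1}$ are feasible for all $0\le t\le p-2$, except that when $|W(G)|=4$ and $t=p/2-1$ one instead requires $\phi(z_{p/2-1},z_{p/2})=0$ and $\delta(z_{p/2-1},z_{p/2})=1$. -}

module Defs where

open import Data.Nat using (ℕ; zero; suc; _+_; _*_; _∸_; _≤_; _<_; _⊔_; _⊓_; _≡ᵇ_; _≤ᵇ_; ∣_-_∣)
open import Data.Bool using (Bool; true; false; _∧_; _∨_; not; if_then_else_)
open import Data.List using (List; []; _∷_; map; foldr; length; filterᵇ; cartesianProduct; allFin; concatMap)
open import Data.Bool.ListAction using (any; all)
open import Data.Nat.ListAction using (sum)
open import Data.Fin using (Fin; toℕ)
import Data.Fin as F
open import Data.Product using (_×_; _,_; Σ; ∃)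
open import Data.Product.Properties using (≡-dec)
open import Relation.Binary.PropositionalEquality using (_≡_; _≢_)
open import Relation.Binary.Definitions using (DecidableEquality)
open import Relation.Nullary.Decidable using (⌊_⌋)
open import Data.Integer as ℤ using (ℤ; +_)
import Data.Empty
import Data.Nat

record Graph : Set₁ where
  field
    V     : Set
    _≟V_  : DecidableEquality V
    elems : List V            -- all vertices (each exactly once)
    adj   : V → V → Bool

open Graph public

maxL : List ℕ → ℕ
maxL = foldr _⊔_ 0

minL : List ℕ → ℕ
minL []           = 0
minL (x ∷ [])     = x
minL (x ∷ y ∷ xs) = x ⊓ minL (y ∷ xs)

module _ (G : Graph) where
  private
    eqb : V G → V G → Bool
    eqb u v = ⌊ (G ._≟V_) u v ⌋

  reach : ℕ → V G → V G → Bool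
  reach zero    u v = eqb u v
  reach (suc k) u v = reach k u v ∨ any (λ w → reach k u w ∧ adj G w v) (elems G)

  order : ℕ
  order = length (elems G)

  -- d(u,v): least k with a walk of length k (default: order, never
  -- attained in a connected graph)
  dist : V G → V G → ℕ
  dist u v = go order 0
    where
    go : ℕ → ℕ → ℕ
    go zero    k = k
    go (suc f) k = if reach k u v then k else go f (suc k)

  diam : ℕ
  diam = maxL (concatMap (λ u → map (dist u) (elems G)) (elems G))

  Simple : Set
  Simple = (∀ u v → adj G u v ≡ adj G v u) × (∀ u → adj G u u ≡ false)

  Connected : Set
  Connected = ∀ u v → reach order u v ≡ true

  weight : V G → ℕ
  weight v = sum (map (λ u → dist u v) (elems G))

  centers : List (V G)
  centers = filterᵇ (λ v → all (λ u → weight v ≤ᵇ weight u) (elems G)) (elems G)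

  nW : ℕ
  nW = length centers

  level : V G → ℕ
  level u = minL (map (dist u) centers)

  totalLevel : ℕ
  totalLevel = sum (map level (elems G))

  -- u is an ancestor of v: u lies on the (unique, geodesic) path from v
  -- to its nearest weight center w
  ancestor : V G → V G → Bool
  ancestor u v = any (λ w → (dist v w ≡ᵇ level v) ∧ ((dist v u + dist u w) ≡ᵇ dist v w)) centers

  phi : V G → V G → ℕ
  phi u v = maxL (map level (filterᵇ (λ z → ancestor z u ∧ ancestor z v) (elems G)))

deleteEdge : (G : Graph) → V G → V G → Graph
deleteEdge G a b = record
  { V = V G ; _≟V_ = G ._≟V_ ; elems = elems G
  ; adj = λ x y → adj G x y ∧ not ((⌊ (G ._≟V_) x a ⌋ ∧ ⌊ (G ._≟V_) y b ⌋) ∨ (⌊ (G ._≟V_) x b ⌋ ∧ ⌊ (G ._≟V_) y a ⌋)) }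

delta : (G : Graph) → V G → V G → ℕ
delta G u v with centers G
... | w ∷ w' ∷ [] = if reach (deleteEdge G w w') (order G) u v then 0 else 1
... | _            = 0

finGraph : (m : ℕ) → (Fin m → Fin m → Bool) → Graph
finGraph m A = record { V = Fin m ; _≟V_ = F._≟_ ; elems = allFin m ; adj = A }

edgeCount : (m : ℕ) → (Fin m → Fin m → Bool) → ℕ
edgeCount m A = length (filterᵇ (λ (p : Fin m × Fin m) → let (u , v) = p in A u v ∧ (toℕ u Data.Nat.<ᵇ toℕ v))
                                 (cartesianProduct (allFin m) (allFin m)))

IsTree : (m : ℕ) → (Fin m → Fin m → Bool) → Set
IsTree m A = Simple (finGraph m A) × Connected (finGraph m A) × (edgeCount m A + 1 ≡ m)

_□_ : Graph → Graph → Graph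
G □ H = record
  { V = V G × V H
  ; _≟V_ = ≡-dec (G ._≟V_) (H ._≟V_)
  ; elems = cartesianProduct (elems G) (elems H)
  ; adj = λ p q → let (x , y) = p ; (x' , y') = q in
      (adj G x x' ∧ ⌊ (H ._≟V_) y y' ⌋) ∨ (⌊ (G ._≟V_) x x' ⌋ ∧ adj H y y') }

module _ (G : Graph) where
  RadioLabeling : (V G → ℕ) → Set
  RadioLabeling f = ∀ u v → u ≢ v → diam G + 1 ∸ dist G u v ≤ ∣ f u - f v ∣

  span : (V G → ℕ) → ℕ
  span f = maxL (map f (elems G)) ∸ minL (map f (elems G))

  RadioNumberIs : ℤ → Set
  RadioNumberIs k = (Σ (V G → ℕ) λ f → RadioLabeling f × (+ span f ≡ k))
                  × (∀ f → RadioLabeling f → k ℤ.≤ + span f)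

module Prod (T₁ T₂ : Graph) where
  VG : Set
  VG = V T₁ × V T₂

  Lz : VG → ℕ
  Lz (x , y) = level T₁ x + level T₂ y

  φz : VG → VG → ℕ
  φz (x , y) (x' , y') = phi T₁ x x' + phi T₂ y y'

  δz : VG → VG → ℕ
  δz (x , y) (x' , y') = delta T₁ x x' + delta T₂ y y'

  ξ : ℕ
  ξ = nW T₁ + nW T₂ ∸ 2

  nWG : ℕ
  nWG = nW T₁ * nW T₂

  Feasible : VG → VG → Set
  Feasible a b = (φz a b ≡ 0) × (δz a b ≡ ξ)

  sumFrom : ℕ → ℕ → (ℕ → ℕ) → ℕ
  sumFrom a zero    f = 0
  sumFrom a (suc k) f = f a + sumFrom (suc a) k f

  GoodOrdering : Set
  GoodOrdering =
    let G = T₁ □ T₂ ; p = order G ; d = diam T₁ + diam T₂ in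
    Σ (ℕ → VG) λ z →
      (∀ v → ∃ λ t → t < p × z t ≡ v) ×
      (∀ s t → s < p → t < p → z s ≡ z t → s ≡ t) ×
      (∀ t → suc t < p →
          ((nWG ≡ 4 × 2 * suc t ≡ p) → (φz (z t) (z (suc t)) ≡ 0) × (δz (z t) (z (suc t)) ≡ 1)) ×
          (((nWG ≡ 4 × 2 * suc t ≡ p) → Data.Empty.⊥) → Feasible (z t) (z (suc t)))) ×
      ((nWG ≡ 1 → Lz (z 0) + Lz (z (p ∸ 1)) ≡ 1) ×
       (2 ≤ nWG → Lz (z 0) + Lz (z (p ∸ 1)) ≡ 0)) ×
      (∀ a b → a < b → b < p →
          (+ sumFrom a (b ∸ a) (λ t → Lz (z t) + Lz (z (suc t)) + δz (z t) (z (suc t))))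
            ℤ.- (+ ((b ∸ a ∸ 1) * (d + 1)))
          ℤ.≤ + dist G (z a) (z b))

{-# OPTIONS --safe #-}

-- In a tree, d(u,v) = L(u) + L(v) + δ(u,v) − 2φ(u,v), and the same formula holds in
-- the product because both sides add over the factors.  List V(G) as z₀, …, z_{p−1} in
-- increasing order of a radio labeling f.  Summing the p − 1 conditions for
-- consecutive vertices gives
--   span f ≥ (p−1)(d+1) − 2L(G) + L(z₀) + L(z_{p−1}) − Σδ(z_t,z_{t+1}) + 2Σφ(z_t,z_{t+1}).
-- The stated value is this bound with φ = 0, the least possible L(z₀) + L(z_{p−1}) and
-- the greatest possible Σδ, so it is attained exactly when all these are extremal and
-- all consecutive conditions are equalities; condition (b) is then the radio condition
-- for the remaining pairs.  With four weight centres Σδ cannot reach 2(p−1), since steps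
-- with δ = 2 stay inside a pair of opposite sectors.  So exactly one step has δ = 1, and
-- it sits in the middle because each pair of opposite sectors has p/2 vertices.

module Submission where

open import Defs
open import Data.Nat using (ℕ; zero; suc; _+_; _*_; _∸_; _≤_; _<_; z≤n; s≤s; s≤s⁻¹; _≤ᵇ_; _<ᵇ_; ∣_-_∣)
open import Data.Nat.Properties
open import Data.Nat.ListAction using (sum)
open import Data.Nat.ListAction.Properties using (sum-++; sum-↭)
open import Data.Nat.Tactic.RingSolver using (solve-∀)
open import Data.Bool using (Bool; true; false; _∧_; not; if_then_else_; _xor_; T; T?)
open import Data.Bool.Properties using (T-≡; T-∧; T-∨; ¬-not)
open import Data.Empty using (⊥; ⊥-elim)
open import Data.Fin using (Fin; zero; suc; toℕ)
import Data.Fin as F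
open import Data.Fin.Properties using (toℕ-injective; toℕ<n; injective⇒≤)
open import Data.List using (List; []; _∷_; length; lookup; map; filterᵇ; concatMap; allFin; applyUpTo; cartesianProduct)
open import Data.List.Properties using (length-tabulate; length-++; length-map; map-++; map-∘)
open import Data.List.Membership.Propositional using (_∈_; find; lose)
open import Data.List.Membership.Propositional.Properties
  using (∈-map⁺; ∈-map⁻; ∈-filter⁺; ∈-filter⁻; ∈-allFin; ∈-applyUpTo⁺; ∈-cartesianProduct⁺; ∈-concatMap⁺; ∈-concatMap⁻)
open import Data.List.Membership.Propositional.Properties.WithK using (unique∧set⇒bag)
open import Data.List.Relation.Binary.BagAndSetEquality using (∼bag⇒↭)
open import Data.List.Relation.Binary.Permutation.Propositional using (_↭_; ↭-sym; ↭⇒↭ₛ)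
open import Data.List.Relation.Binary.Permutation.Propositional.Properties
  using (∈-resp-↭; ↭-length) renaming (map⁺ to ↭-map⁺)
import Data.List.Relation.Binary.Permutation.Setoid.Properties as Permₛ
import Data.List.Relation.Unary.All as All
open import Data.List.Relation.Unary.All.Properties using (all⁺; all⁻)
open import Data.List.Relation.Unary.AllPairs using (_∷_)
open import Data.List.Relation.Unary.Any using (here; there; index)
open import Data.List.Relation.Unary.Any.Properties using (any⁺; any⁻; lookup-index)
open import Data.List.Relation.Unary.Linked using (Linked; [-]; _∷_)
open import Data.List.Relation.Unary.Unique.Propositional using (Unique)
import Data.List.Relation.Unary.Unique.Propositional.Properties as Uniqueₚ
open import Data.List.Sort using (sort; sort-↭; sort-↗)
open import Data.Product using (_×_; _,_; Σ; ∃; ∃-syntax; proj₁; proj₂)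
open import Data.Product.Properties using (,-injective)
open import Data.Sum using (_⊎_; inj₁; inj₂)
open import Function using (_∘_; case_of_)
open import Function.Bundles using (_⇔_; mk⇔; Equivalence)
import Relation.Binary.Construct.On as On
open import Relation.Binary.Definitions using (Tri; tri<; tri≈; tri>)
open import Relation.Binary.PropositionalEquality
open import Relation.Nullary using (¬_; Dec; yes; no)
open import Relation.Nullary.Decidable using (toWitness; fromWitness)

-- Walks and distance

-- `IsTree` says connected with m - 1 edges, while the metric arguments need acyclicity. It is used
-- in the form `ParentUnique`: seen from any root, a vertex has at most one neighbour that is not
-- farther away. This yields medians, and the median of u, v and a common nearest centre is their
-- deepest common ancestor, which is the source of φ in the distance formula. Two centres have equal
-- weight. This makes them adjacent, and it makes the two sides of their edge equally large, since
-- passing from one centre to the other changes every distance by exactly one. That balance is the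
-- origin of p/2. The three cases differ only in two extremal numbers: a lower bound e for L(z₀) +
-- L(z_{p-1}) and an upper bound Δ for Σδ, with (e, Δ) = (1, 0), (0, p-1) and (0, 2p-3). The
-- equivalence is proved once for arbitrary such bounds. Since subtraction truncates in ℕ,
-- inequalities are kept additive and pass to ℤ only for the final values.

true⇒T : ∀ {b} → b ≡ true → T b
true⇒T = Equivalence.from T-≡

T⇒true : ∀ {b} → T b → b ≡ true
T⇒true = Equivalence.to T-≡

-- `g f k` is the linear search with fuel f that starts at k. These two equations are all that the
-- later lemmas know about the loop inside `dist`.
record Search (r : ℕ → Bool) (g : ℕ → ℕ → ℕ) : Set where
  field
    stop : ∀ k → g 0 k ≡ k
    next : ∀ f k → g (suc f) k ≡ (if r k then k else g f (suc k))

-- `dist` is computed by a local function that cannot be named here; unification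
-- recovers it once its two arguments have been generalised to variables.
dist-search : ∀ G u v → ∃[ g ] Search (λ k → reach G k u v) g × g (order G) 0 ≡ dist G u v
dist-search G u v = go , record { stop = λ _ → refl ; next = λ _ _ → refl } , unfold
  where
  go : ℕ → ℕ → ℕ
  go = _
  unfold : go (order G) 0 ≡ dist G u v
  unfold with order G
  ... | o with 0
  ...   | k = refl

dist-elim : ∀ G u v (P : ℕ → Set) →
  (∀ g → Search (λ k → reach G k u v) g → P (g (order G) 0)) → P (dist G u v)
dist-elim G u v P h = let g , S , eq = dist-search G u v in subst P eq (h g S)

module _ {r g} (S : Search r g) where
  open Search S

  search-≥ : ∀ f k → k ≤ g f k
  search-≥ zero k rewrite stop k = ≤-refl
  search-≥ (suc f) k rewrite next f k with r k
  ... | true  = ≤-refl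
  ... | false = ≤-trans (n≤1+n k) (search-≥ f (suc k))

  search-≤ : ∀ f k → g f k ≤ k + f
  search-≤ zero k rewrite stop k = m≤m+n k 0
  search-≤ (suc f) k rewrite next f k with r k
  ... | true  = m≤m+n k (suc f)
  ... | false = ≤-trans (search-≤ f (suc k)) (≤-reflexive (sym (+-suc k f)))

  -- The strict bound rules out exhausted fuel: the value k + f is returned there as a default,
  -- without a test of `r`.
  search-found : ∀ f k → g f k < k + f → r (g f k) ≡ true
  search-found zero k lt rewrite stop k = ⊥-elim (<-irrefl (sym (+-identityʳ k)) lt)
  search-found (suc f) k lt rewrite next f k with r k in eq
  ... | true  = eq
  ... | false = search-found f (suc k) (<-≤-trans lt (≤-reflexive (+-suc k f)))

  search-least : ∀ f k j → k ≤ j → j < g f k → r j ≡ false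
  search-least zero k j k≤j lt rewrite stop k = ⊥-elim (<⇒≱ lt k≤j)
  search-least (suc f) k j k≤j lt rewrite next f k with r k in eq
  ... | true  = ⊥-elim (<⇒≱ lt k≤j)
  ... | false with k ≟ j
  ...   | yes refl = eq
  ...   | no k≢j   = search-least f (suc k) j (≤∧≢⇒< k≤j k≢j) lt

module Walks (G : Graph) where

  Adj : V G → V G → Set
  Adj u v = adj G u v ≡ true

  -- Walks grow at their far end, as `reach` does.
  data Walk : ℕ → V G → V G → Set where
    nil  : ∀ {u} → Walk 0 u u
    snoc : ∀ {k u w v} → Walk k u w → Adj w v → Walk (suc k) u v

  _++ʷ_ : ∀ {j k u v w} → Walk j u v → Walk k v w → Walk (k + j) u w
  p ++ʷ nil      = p
  p ++ʷ snoc q e = snoc (p ++ʷ q) e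

  uncons : ∀ {k u v} → Walk (suc k) u v → ∃[ w ] Adj u w × Walk k w v
  uncons (snoc nil e) = _ , e , nil
  uncons (snoc (snoc p e) e′) =
    let w , f , q = uncons (snoc p e) in w , f , snoc q e′

  walk-preserves : (P : V G → Set) → (∀ {u v} → Adj u v → P u → P v) →
    ∀ {k u v} → Walk k u v → P u → P v
  walk-preserves P step nil        pu = pu
  walk-preserves P step (snoc p e) pu = step e (walk-preserves P step p pu)

  reach-suc⁻ : ∀ k u v → reach G (suc k) u v ≡ true →
    reach G k u v ≡ true ⊎ (∃[ w ] reach G k u w ≡ true × Adj w v)
  reach-suc⁻ k u v r with Equivalence.to T-∨ (true⇒T r)
  ... | inj₁ t = inj₁ (T⇒true t)
  ... | inj₂ t with find (any⁻ _ (elems G) t)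
  ...   | w , _ , tw with Equivalence.to T-∧ tw
  ...     | a , b = inj₂ (w , T⇒true a , T⇒true b)

  reach⇒Walk : ∀ k u v → reach G k u v ≡ true → ∃[ j ] j ≤ k × Walk j u v
  reach⇒Walk zero u v r with toWitness {a? = _≟V_ G u v} (true⇒T r)
  ... | refl = 0 , z≤n , nil
  reach⇒Walk (suc k) u v r with reach-suc⁻ k u v r
  ... | inj₁ r′ = let j , j≤k , p = reach⇒Walk k u v r′ in j , m≤n⇒m≤1+n j≤k , p
  ... | inj₂ (w , r′ , e) = let j , j≤k , p = reach⇒Walk k u w r′ in suc j , s≤s j≤k , snoc p e

  reach-mono : ∀ {j k u v} → j ≤ k → reach G j u v ≡ true → reach G k u v ≡ true
  reach-mono {j} {zero} z≤n r = r
  reach-mono {j} {suc k} {u} {v} j≤k r with j ≟ suc k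
  ... | yes refl = r
  ... | no j≢    = T⇒true (Equivalence.from T-∨ (inj₁ (true⇒T (reach-mono {k = k} (s≤s⁻¹ (≤∧≢⇒< j≤k j≢)) r))))

  module Complete (complete : ∀ v → v ∈ elems G) where

    Walk⇒reach : ∀ {k u v} → Walk k u v → reach G k u v ≡ true
    Walk⇒reach {u = u} nil = T⇒true (fromWitness {a? = _≟V_ G u u} refl)
    Walk⇒reach (snoc {w = w} p e) = T⇒true (Equivalence.from T-∨ (inj₂ (any⁺ _
      (lose (complete w) (Equivalence.from T-∧ (true⇒T (Walk⇒reach p) , true⇒T e))))))

    dist-minimal : ∀ {k u v} → Walk k u v → dist G u v ≤ k
    dist-minimal {k} {u} {v} p = dist-elim G u v (_≤ k) λ g S → ≮⇒≥ λ lt →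
      case-false (trans (sym (search-least S (order G) 0 k z≤n lt)) (Walk⇒reach p))
      where
      case-false : ¬ false ≡ true
      case-false ()

    dist≤order : ∀ u v → dist G u v ≤ order G
    dist≤order u v = dist-elim G u v (_≤ order G) λ g S → search-≤ S (order G) 0

    -- The connecting walk has length at most the order, where `dist` gives up.
    dist-attained : ∀ {k u v} → Walk k u v → k ≤ order G → Walk (dist G u v) u v
    dist-attained {k} {u} {v} p k≤o with m≤n⇒m<n∨m≡n (dist≤order u v)
    ... | inj₁ lt = subst (λ j → Walk j u v) (≤-antisym j≤ (dist-minimal q)) q
      where
      r = dist-elim G u v (λ d → d < order G → reach G d u v ≡ true)
            (λ g S → search-found S (order G) 0) lt
      w  = reach⇒Walk _ u v r
      j≤ = proj₁ (proj₂ w)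
      q  = proj₂ (proj₂ w)
    ... | inj₂ eq = subst (λ j → Walk j u v) (≤-antisym (≤-trans k≤o (≤-reflexive (sym eq))) (dist-minimal p)) p

-- Metric properties of trees

-- Linear arithmetic in one step: the hypotheses are added up into x ≤ y, and the ring
-- identity checks that this is the goal up to moving terms across.
linear : ∀ {x y a b} → x ≤ y → a + y ≡ x + b → a ≤ b
linear {x} {y} {a} {b} x≤y eq = +-cancelˡ-≤ x a b (begin
  x + a ≤⟨ +-monoˡ-≤ a x≤y ⟩
  y + a ≡⟨ +-comm y a ⟩
  a + y ≡⟨ eq ⟩
  x + b ∎)
  where open ≤-Reasoning

module Metric (G : Graph) (complete : ∀ v → v ∈ elems G)
              (adj-symm : ∀ u v → adj G u v ≡ adj G v u) (connected : Connected G) where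

  open Walks G public
  open Complete complete public

  d : V G → V G → ℕ
  d = dist G

  Adj-sym : ∀ {u v} → Adj u v → Adj v u
  Adj-sym {u} {v} e = trans (adj-symm v u) e

  geodesic : ∀ u v → Walk (d u v) u v
  geodesic u v = let k , k≤ , p = reach⇒Walk (order G) u v (connected u v) in dist-attained p k≤

  reverseʷ : ∀ {k u v} → Walk k u v → Walk k v u
  reverseʷ nil = nil
  reverseʷ {suc k} {u} {v} (snoc p e) = subst (λ j → Walk j v u) (+-comm k 1) (snoc nil (Adj-sym e) ++ʷ reverseʷ p)

  d-refl : ∀ u → d u u ≡ 0
  d-refl u = n≤0⇒n≡0 (dist-minimal nil)

  d≡0⇒≡ : ∀ {u v} → d u v ≡ 0 → u ≡ v
  d≡0⇒≡ {u} {v} eq = go (subst (λ k → Walk k u v) eq (geodesic u v))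
    where
    go : Walk 0 u v → u ≡ v
    go nil = refl

  d-sym : ∀ u v → d u v ≡ d v u
  d-sym u v = ≤-antisym (dist-minimal (reverseʷ (geodesic v u))) (dist-minimal (reverseʷ (geodesic u v)))

  triangle : ∀ u v w → d u w ≤ d u v + d v w
  triangle u v w = ≤-trans (dist-minimal (geodesic u v ++ʷ geodesic v w)) (≤-reflexive (+-comm (d v w) (d u v)))

  d-adj≤ : ∀ {u v} w → Adj u v → d w v ≤ suc (d w u)
  d-adj≤ w e = dist-minimal (snoc (geodesic w _) e)

  d-step : ∀ {k} u v → d u v ≡ suc k → ∃[ w ] Adj u w × d w v ≡ k
  d-step {k} u v eq = let w , e , p = uncons (subst (λ j → Walk j u v) eq (geodesic u v)) in
    w , e , ≤-antisym (dist-minimal p) (s≤s⁻¹ (begin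
      suc k        ≡⟨ sym eq ⟩
      d u v        ≡⟨ d-sym u v ⟩
      d v u        ≤⟨ d-adj≤ v (Adj-sym e) ⟩
      suc (d v w)  ≡⟨ cong suc (d-sym v w) ⟩
      suc (d w v)  ∎))
    where open ≤-Reasoning

  Between : V G → V G → V G → Set
  Between u z v = d u z + d z v ≡ d u v

-- Acyclicity in metric form. The inequalities are not strict, so that an edge between two vertices
-- equally far from r is excluded as well as a second parent.
ParentUnique : Graph → Set
ParentUnique G = ∀ {r v a b} → Adj v a → Adj v b →
  dist G r a ≤ dist G r v → dist G r b ≤ dist G r v → a ≡ b
  where open Walks G

module Tree (G : Graph) (complete : ∀ v → v ∈ elems G)
            (simple : Simple G) (connected : Connected G)
            (parent-unique : ParentUnique G) where

  open Metric G complete (proj₁ simple) connected public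

  ¬Adj-refl : ∀ {u} → ¬ Adj u u
  ¬Adj-refl {u} e with trans (sym e) (proj₂ simple u)
  ... | ()

  Adj⇒d≡1 : ∀ {u v} → Adj u v → d u v ≡ 1
  Adj⇒d≡1 {u} {v} e with d u v in eq | d-adj≤ u e
  ... | 0 | _ = ⊥-elim (¬Adj-refl (subst (Adj u) (sym (d≡0⇒≡ eq)) e))
  ... | suc k | le = ≤-antisym (≤-trans le (≤-reflexive (cong suc (d-refl u)))) (s≤s z≤n)

  -- If a and b were equally far from r, then b and the next vertex from a towards r would both be
  -- neighbours of a that are not farther than a. They would coincide, although their distances
  -- differ.
  adj-≢ : ∀ {a b} r → Adj a b → d r a ≢ d r b
  adj-≢ {a} {b} r e eq with d r a in ea
  ... | zero = ¬Adj-refl (subst (Adj a) (trans (sym (d≡0⇒≡ (sym eq))) (d≡0⇒≡ ea)) e)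
  ... | suc k with d-step a r (trans (d-sym a r) ea)
  ...   | c , f , dc = 1+n≢n (trans eq (trans (cong (d r) (parent-unique e f
            (≤-reflexive (trans (sym eq) (sym ea)))
            (≤-trans (≤-reflexive drc) (≤-trans (n≤1+n k) (≤-reflexive (sym ea)))))) drc))
      where drc = trans (d-sym r c) dc

  adj-cases : ∀ {a b} r → Adj a b → d r b ≡ suc (d r a) ⊎ d r a ≡ suc (d r b)
  adj-cases {a} {b} r e with <-cmp (d r a) (d r b)
  ... | tri< lt _ _ = inj₁ (≤-antisym (d-adj≤ r e) lt)
  ... | tri≈ _ eq _ = ⊥-elim (adj-≢ r e eq)
  ... | tri> _ _ gt = inj₂ (≤-antisym (d-adj≤ r (Adj-sym e)) gt)

  -- A geodesic that starts by moving away from r never turns back.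
  recede : ∀ k {r v x y} → Adj x y → d x v ≡ suc k → d y v ≡ k → d r x < d r y → d r v ≡ d r y + k
  recede zero {r} e dx dy lt = trans (cong (d r) (sym (d≡0⇒≡ dy))) (sym (+-identityʳ _))
  recede (suc k) {r} {v} {x} {y} e dx dy lt with d-step y v dy
  ... | z , f , dz with adj-cases r f
  ...   | inj₁ up = trans (recede k f dy dz (≤-reflexive (sym up)))
                      (trans (cong (_+ k) up) (sym (+-suc (d r y) k)))
  ...   | inj₂ down with parent-unique (Adj-sym e) f (<⇒≤ lt) (≤-trans (n≤1+n _) (≤-reflexive (sym down)))
  ...     | refl = ⊥-elim (<⇒≢ (m≤n⇒m≤1+n ≤-refl) (trans (sym dz) dx))

  -- Walk from u towards v as long as each step also approaches w. At the first step that moves away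
  -- from w, `recede` shows that the rest of the geodesic keeps moving away, so the vertex reached
  -- lies on all three geodesics.
  median : ∀ u v w → ∃[ z ] Between u z v × Between v z w × Between u z w
  median u v w = go (d u v) u refl
    where
    open ≤-Reasoning
    go : ∀ k u → d u v ≡ k → ∃[ z ] Between u z v × Between v z w × Between u z w
    go zero u eq with d≡0⇒≡ eq
    ... | refl = u , cong (_+ d u u) (d-refl u) , cong (_+ d u w) (d-refl u) , cong (_+ d u w) (d-refl u)
    go (suc k) u eq with d-step u v eq
    ... | x , e , dx with adj-cases w e
    ...   | inj₁ up = u , cong (_+ d u v) (d-refl u) , vuw , cong (_+ d u w) (d-refl u)
      where
      vuw : d v u + d u w ≡ d v w
      vuw = begin-equality
        d v u + d u w    ≡⟨ cong₂ _+_ (trans (d-sym v u) eq) (d-sym u w) ⟩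
        suc k + d w u    ≡⟨ cong suc (+-comm k (d w u)) ⟩
        suc (d w u) + k  ≡⟨ cong (_+ k) (sym up) ⟩
        d w x + k        ≡⟨ sym (recede k e eq dx (≤-reflexive (sym up))) ⟩
        d w v            ≡⟨ d-sym w v ⟩
        d v w            ∎
    ...   | inj₂ down with go k x dx
    ...     | z , xzv , vzw , xzw = z , extend v (trans eq (cong suc (sym dx))) xzv , vzw ,
                                    extend w (trans (d-sym u w) (trans down (cong suc (d-sym w x)))) xzw
      where
      extend : ∀ t → d u t ≡ suc (d x t) → Between x z t → Between u z t
      extend t dut xzt = ≤-antisym (begin
        d u z + d z t        ≤⟨ +-monoˡ-≤ (d z t) (triangle u x z) ⟩
        d u x + d x z + d z t ≡⟨ +-assoc (d u x) (d x z) (d z t) ⟩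
        d u x + (d x z + d z t) ≡⟨ cong₂ _+_ (Adj⇒d≡1 e) xzt ⟩
        suc (d x t)          ≡⟨ sym dut ⟩
        d u t                ∎) (triangle u z t)

-- Levels and weight centres

maxL-upper : ∀ {x xs} → x ∈ xs → x ≤ maxL xs
maxL-upper {xs = y ∷ ys} (here refl) = m≤m⊔n y (maxL ys)
maxL-upper {xs = y ∷ ys} (there x∈)  = ≤-trans (maxL-upper x∈) (m≤n⊔m y (maxL ys))

maxL-least : ∀ {b} xs → (∀ {x} → x ∈ xs → x ≤ b) → maxL xs ≤ b
maxL-least []       h = z≤n
maxL-least (x ∷ xs) h = ⊔-lub (h (here refl)) (maxL-least xs (h ∘ there))

maxL-attained : ∀ xs → maxL xs ≡ 0 ⊎ maxL xs ∈ xs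
maxL-attained [] = inj₁ refl
maxL-attained (x ∷ xs) with ⊔-sel x (maxL xs)
... | inj₁ eq = inj₂ (here eq)
... | inj₂ eq with maxL-attained xs
...   | inj₁ eq₀ = inj₁ (trans eq eq₀)
...   | inj₂ m∈  = inj₂ (there (subst (_∈ xs) (sym eq) m∈))

minL-lower : ∀ {x xs} → x ∈ xs → minL xs ≤ x
minL-lower {xs = y ∷ []}     (here refl) = ≤-refl
minL-lower {xs = y ∷ z ∷ ys} (here refl) = m⊓n≤m y _
minL-lower {xs = y ∷ z ∷ ys} (there x∈)  = ≤-trans (m⊓n≤n y _) (minL-lower x∈)

minL-attained : ∀ x xs → minL (x ∷ xs) ∈ x ∷ xs
minL-attained x [] = here refl
minL-attained x (y ∷ ys) with ⊓-sel x (minL (y ∷ ys))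
... | inj₁ eq = here eq
... | inj₂ eq = there (subst (_∈ y ∷ ys) (sym eq) (minL-attained y ys))

bit : Bool → ℕ
bit b = if b then 1 else 0

module _ {A : Set} where

  sum-mono : ∀ {f g : A → ℕ} xs → (∀ x → f x ≤ g x) → sum (map f xs) ≤ sum (map g xs)
  sum-mono []       h = z≤n
  sum-mono (x ∷ xs) h = +-mono-≤ (h x) (sum-mono xs h)

  sum-cong : ∀ {f g : A → ℕ} xs → (∀ x → f x ≡ g x) → sum (map f xs) ≡ sum (map g xs)
  sum-cong []       h = refl
  sum-cong (x ∷ xs) h = cong₂ _+_ (h x) (sum-cong xs h)

  sum-+ : ∀ (f g : A → ℕ) xs → sum (map (λ x → f x + g x) xs) ≡ sum (map f xs) + sum (map g xs)
  sum-+ f g []       = refl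
  sum-+ f g (x ∷ xs) = trans (cong (f x + g x +_) (sum-+ f g xs)) (interchange (f x) (g x) _ _)
    where
    interchange : ∀ a b c e → a + b + (c + e) ≡ a + c + (b + e)
    interchange = solve-∀

  sum-* : ∀ c (f : A → ℕ) xs → sum (map (λ x → c * f x) xs) ≡ c * sum (map f xs)
  sum-* c f []       = sym (*-zeroʳ c)
  sum-* c f (x ∷ xs) = trans (cong (c * f x +_) (sum-* c f xs)) (sym (*-distribˡ-+ c (f x) _))

  sum-const : ∀ c (xs : List A) → sum (map (λ _ → c) xs) ≡ length xs * c
  sum-const c []       = refl
  sum-const c (x ∷ xs) = cong (c +_) (sum-const c xs)

module TreeCenters (G : Graph) (complete : ∀ v → v ∈ elems G) (unique : Unique (elems G))
            (simple : Simple G) (connected : Connected G)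
            (parent-unique : ParentUnique G) where

  open Tree G complete simple connected parent-unique public

  C : List (V G)
  C = centers G

  ℓ : V G → ℕ
  ℓ = level G

  ∈-centers⁺ : ∀ {c} → (∀ u → weight G c ≤ weight G u) → c ∈ C
  ∈-centers⁺ {c} h = ∈-filter⁺ (T? ∘ _) (complete c)
    (all⁻ (λ u → weight G c ≤ᵇ weight G u) {xs = elems G} (All.universal (λ u → ≤⇒≤ᵇ (h u)) (elems G)))

  ∈-centers⁻ : ∀ {c} → c ∈ C → ∀ u → weight G c ≤ weight G u
  ∈-centers⁻ {c} c∈ u = ≤ᵇ⇒≤ _ _ (All.lookup (all⁺ _ _ (proj₂ (∈-filter⁻ (T? ∘ _) {xs = elems G} c∈))) (complete u))

  ℓ-lower : ∀ {c} u → c ∈ C → ℓ u ≤ d u c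
  ℓ-lower u c∈ = minL-lower (∈-map⁺ (d u) c∈)

  ℓ-attained : ∀ {c} u → c ∈ C → ∃[ c′ ] c′ ∈ C × ℓ u ≡ d u c′
  ℓ-attained u c∈ = go C c∈
    where
    go : ∀ xs {c} → c ∈ xs → ∃[ c′ ] c′ ∈ xs × minL (map (d u) xs) ≡ d u c′
    go (x ∷ xs) _ = ∈-map⁻ (d u) (minL-attained (d u x) (map (d u) xs))

  ancestor⁻ : ∀ {z u} → T (ancestor G z u) → ∃[ c ] c ∈ C × d u c ≡ ℓ u × Between u z c
  ancestor⁻ {z} {u} t with find (any⁻ _ C t)
  ... | c , c∈ , tc = let a , b = Equivalence.to T-∧ tc in c , c∈ , ≡ᵇ⇒≡ _ _ a , ≡ᵇ⇒≡ _ _ b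

  ancestor⁺ : ∀ {z u c} → c ∈ C → d u c ≡ ℓ u → Between u z c → T (ancestor G z u)
  ancestor⁺ c∈ e b = any⁺ _ (lose c∈ (Equivalence.from T-∧ (≡⇒≡ᵇ _ _ e , ≡⇒≡ᵇ _ _ b)))

  phi-upper : ∀ {z u v} → T (ancestor G z u) → T (ancestor G z v) → ℓ z ≤ phi G u v
  phi-upper {z} au av = maxL-upper (∈-map⁺ ℓ (∈-filter⁺ _ (complete z) (Equivalence.from T-∧ (au , av))))

  phi-attained : ∀ u v → phi G u v ≡ 0 ⊎ (∃[ z ] T (ancestor G z u) × T (ancestor G z v) × phi G u v ≡ ℓ z)
  phi-attained u v with maxL-attained (map ℓ (filterᵇ (λ z → ancestor G z u ∧ ancestor G z v) (elems G)))
  ... | inj₁ eq = inj₁ eq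
  ... | inj₂ m∈ with ∈-map⁻ ℓ m∈
  ...   | z , z∈ , eq with Equivalence.to T-∧ (proj₂ (∈-filter⁻ (T? ∘ _) {xs = elems G} z∈))
  ...     | au , av = inj₂ (z , au , av , eq)

  -- `ancestor` quantifies over all nearest centres. The field `only` makes the nearest centre
  -- unique, so that being an ancestor of u becomes lying between u and c.
  record Home (c u : V G) : Set where
    field
      center  : c ∈ C
      nearest : d u c ≡ ℓ u
      only    : ∀ {c′} → c′ ∈ C → d u c′ ≡ ℓ u → c′ ≡ c

  open Home

  -- By the triangle inequality through z, a centre that beats or ties with c at z would do the same
  -- at u.
  Home-between : ∀ {c u z} → Home c u → Between u z c → Home c z
  Home-between {c} {u} {z} h b = record
    { center  = center h
    ; nearest = ≤-antisym dzc≤ (ℓ-lower z (center h))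
    ; only    = λ {c′} c′∈ e → only h c′∈ (≤-antisym (begin
        d u c′          ≤⟨ triangle u z c′ ⟩
        d u z + d z c′  ≡⟨ cong (d u z +_) e ⟩
        d u z + ℓ z     ≤⟨ +-monoʳ-≤ (d u z) (ℓ-lower z (center h)) ⟩
        d u z + d z c   ≡⟨ b ⟩
        d u c           ≡⟨ nearest h ⟩
        ℓ u             ∎) (ℓ-lower u c′∈))
    }
    where
    open ≤-Reasoning
    dzc≤ : d z c ≤ ℓ z
    dzc≤ with ℓ-attained z (center h)
    ... | c′ , c′∈ , eq = +-cancelˡ-≤ (d u z) _ _ (begin
        d u z + d z c   ≡⟨ b ⟩
        d u c           ≡⟨ nearest h ⟩
        ℓ u             ≤⟨ ℓ-lower u c′∈ ⟩
        d u c′          ≤⟨ triangle u z c′ ⟩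
        d u z + d z c′  ≡⟨ cong (d u z +_) (sym eq) ⟩
        d u z + ℓ z     ∎)

  ancestor-Home : ∀ {c u z} → Home c u → T (ancestor G z u) → Between u z c
  ancestor-Home h t with ancestor⁻ t
  ... | c′ , c′∈ , e , b with only h c′∈ e
  ...   | refl = b

  Home-ancestor : ∀ {c u z} → Home c u → Between u z c → T (ancestor G z u)
  Home-ancestor h b = ancestor⁺ (center h) (nearest h) b

  ℓ-through : ∀ {c u z} → Home c u → Between u z c → d u z + ℓ z ≡ ℓ u
  ℓ-through {u = u} {z} h b = trans (cong (d u z +_) (sym (nearest (Home-between h b)))) (trans b (nearest h))

  -- For a common ancestor z, the sum d(u,z) + d(z,v) + 2ℓ(z) is exactly ℓ(u) + ℓ(v). The triangle
  -- inequality through a highest-level one gives ≤, with c in its place when φ = 0. The median of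
  -- u, v and c is a common ancestor on the geodesic from u to v and gives ≥.
  dist-same-home : ∀ {c u v} → Home c u → Home c v → d u v + 2 * phi G u v ≡ ℓ u + ℓ v
  dist-same-home {c} {u} {v} hu hv = ≤-antisym upper lower
    where
    open ≤-Reasoning
    regroup : ∀ a b e → a + b + 2 * e ≡ (a + e) + (b + e)
    regroup = solve-∀
    through : ∀ {z} → Between u z c → Between v z c → d u z + d z v + 2 * ℓ z ≡ ℓ u + ℓ v
    through {z} bu bv = trans (regroup (d u z) (d z v) (ℓ z))
      (cong₂ _+_ (ℓ-through hu bu) (trans (cong (_+ ℓ z) (d-sym z v)) (ℓ-through hv bv)))
    upper : d u v + 2 * phi G u v ≤ ℓ u + ℓ v
    upper with phi-attained u v
    ... | inj₁ eq = begin
        d u v + 2 * phi G u v ≡⟨ cong (λ t → d u v + 2 * t) eq ⟩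
        d u v + 0             ≡⟨ +-identityʳ _ ⟩
        d u v                 ≤⟨ triangle u c v ⟩
        d u c + d c v         ≡⟨ cong₂ _+_ (nearest hu) (trans (d-sym c v) (nearest hv)) ⟩
        ℓ u + ℓ v             ∎
    ... | inj₂ (z , au , av , eq) = begin
        d u v + 2 * phi G u v   ≡⟨ cong (λ t → d u v + 2 * t) eq ⟩
        d u v + 2 * ℓ z         ≤⟨ +-monoˡ-≤ (2 * ℓ z) (triangle u z v) ⟩
        d u z + d z v + 2 * ℓ z ≡⟨ through (ancestor-Home hu au) (ancestor-Home hv av) ⟩
        ℓ u + ℓ v               ∎
    lower : ℓ u + ℓ v ≤ d u v + 2 * phi G u v
    lower with median u v c
    ... | z , buv , bv , bu = begin
        ℓ u + ℓ v               ≡⟨ sym (through bu bv) ⟩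
        d u z + d z v + 2 * ℓ z ≡⟨ cong (_+ 2 * ℓ z) buv ⟩
        d u v + 2 * ℓ z         ≤⟨ +-monoʳ-≤ (d u v) (*-monoʳ-≤ 2 (phi-upper (Home-ancestor hu bu) (Home-ancestor hv bv))) ⟩
        d u v + 2 * phi G u v   ∎

  -- A common ancestor would inherit both homes by `Home-between`, but a home is unique.
  phi-different-home : ∀ {c c′ u v} → Home c u → Home c′ v → c ≢ c′ → phi G u v ≡ 0
  phi-different-home {u = u} {v} hu hv c≢c′ with phi-attained u v
  ... | inj₁ eq = eq
  ... | inj₂ (z , au , av , _) = ⊥-elim (c≢c′ (only hz′ (center hz) (nearest hz)))
    where
    hz  = Home-between hu (ancestor-Home hu au)
    hz′ = Home-between hv (ancestor-Home hv av)

  module OneCenter {w} (C≡ : C ≡ w ∷ []) where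

    home : ∀ u → Home w u
    home u = record
      { center  = w∈
      ; nearest = sym (cong (minL ∘ map (d u)) C≡)
      ; only    = λ c∈ _ → only-w (subst (_ ∈_) C≡ c∈)
      }
      where
      w∈ = subst (w ∈_) (sym C≡) (here refl)
      only-w : ∀ {c} → c ∈ w ∷ [] → c ≡ w
      only-w (here eq) = eq

    delta≡0 : ∀ u v → delta G u v ≡ 0
    delta≡0 u v rewrite C≡ = refl

    dist-formula : ∀ u v → d u v + 2 * phi G u v ≡ ℓ u + ℓ v + delta G u v
    dist-formula u v = trans (dist-same-home (home u) (home v))
      (sym (trans (cong (ℓ u + ℓ v +_) (delta≡0 u v)) (+-identityʳ _)))

    ℓ≡0⇒ : ∀ {u} → ℓ u ≡ 0 → u ≡ w
    ℓ≡0⇒ {u} eq = d≡0⇒≡ (trans (nearest (home u)) eq)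

  -- Two weight centres and the edge that joins them

  module TwoCenters {w w′} (C≡ : C ≡ w ∷ w′ ∷ []) where

    w∈ : w ∈ C
    w∈ = subst (w ∈_) (sym C≡) (here refl)

    w′∈ : w′ ∈ C
    w′∈ = subst (w′ ∈_) (sym C≡) (there (here refl))

    only-two : ∀ {c} → c ∈ C → c ≡ w ⊎ c ≡ w′
    only-two c∈ with subst (_ ∈_) C≡ c∈
    ... | here eq         = inj₁ eq
    ... | there (here eq) = inj₂ eq

    w≢w′ : w ≢ w′
    w≢w′ with subst Unique C≡ (Uniqueₚ.filter⁺ (T? ∘ _) unique)
    ... | w≢ ∷ _ = All.lookup w≢ (here refl)

    weights≡ : weight G w ≡ weight G w′
    weights≡ = ≤-antisym (∈-centers⁻ w∈ w′) (∈-centers⁻ w′∈ w)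

    -- The weight is convex along the geodesic from w to w′, so the neighbour of w
    -- on it is a centre as well.
    centers-adjacent : Adj w w′
    centers-adjacent with d w w′ in eq
    ... | zero = ⊥-elim (w≢w′ (d≡0⇒≡ eq))
    ... | suc k with d-step w w′ eq
    ...   | x , e , dx with only-two (∈-centers⁺ λ u → ≤-trans x≤w (∈-centers⁻ w∈ u))
      where
      open ≤-Reasoning
      arith₁ : ∀ k a → suc k * suc a ≡ k * a + (suc a + k)
      arith₁ = solve-∀
      arith₂ : ∀ k a b → suc k * b + (a + k) ≡ b + (k * suc b + a)
      arith₂ = solve-∀
      -- If the step from w to x moves away from u, so does the rest of the geodesic to w′, and
      -- equality holds. Otherwise the triangle inequality through w′ suffices.
      convex : ∀ u → suc k * d u x ≤ k * d u w + d u w′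
      convex u with adj-cases u e
      ... | inj₁ up rewrite recede k e eq dx (≤-reflexive (sym up)) | up = ≤-reflexive (arith₁ k (d u w))
      ... | inj₂ down rewrite down = linear
              (≤-trans (triangle u w′ x) (≤-reflexive (cong (d u w′ +_) (trans (d-sym w′ x) dx))))
              (arith₂ k (d u w′) (d u x))
      x≤w : weight G x ≤ weight G w
      x≤w = *-cancelˡ-≤ (suc k) (begin
        suc k * weight G x                   ≡⟨ sym (sum-* (suc k) (λ u → d u x) (elems G)) ⟩
        _                                    ≤⟨ sum-mono (elems G) convex ⟩
        _                                    ≡⟨ sum-+ (λ u → k * d u w) (λ u → d u w′) (elems G) ⟩
        _                                    ≡⟨ cong (_+ weight G w′) (sum-* k (λ u → d u w) (elems G)) ⟩
        k * weight G w + weight G w′         ≡⟨ cong (k * weight G w +_) (sym weights≡) ⟩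
        k * weight G w + weight G w          ≡⟨ +-comm _ (weight G w) ⟩
        suc k * weight G w                   ∎)
    ...     | inj₁ refl = ⊥-elim (¬Adj-refl e)
    ...     | inj₂ refl = e

    -- Ties cannot occur: the centres are adjacent, and `adj-cases` excludes equal distances.
    side : V G → Bool
    side u = d u w <ᵇ d u w′

    side-true : ∀ {u} → side u ≡ true → d u w′ ≡ suc (d u w)
    side-true {u} s with adj-cases u centers-adjacent
    ... | inj₁ up   = up
    ... | inj₂ down = ⊥-elim (<-asym (<ᵇ⇒< (d u w) (d u w′) (true⇒T s)) (≤-reflexive (sym down)))

    side-false : ∀ {u} → side u ≡ false → d u w ≡ suc (d u w′)
    side-false {u} s with adj-cases u centers-adjacent
    ... | inj₁ up   = ⊥-elim (subst T s (<⇒<ᵇ (≤-reflexive (sym up))))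
    ... | inj₂ down = down

    side-w : side w ≡ true
    side-w = T⇒true (<⇒<ᵇ (≤-reflexive (trans (cong suc (d-refl w)) (sym (Adj⇒d≡1 centers-adjacent)))))

    side-w′ : side w′ ≡ false
    side-w′ with side w′ in s
    ... | false = refl
    ... | true  = ⊥-elim (0≢1+n (trans (sym (d-refl w′)) (side-true s)))

    cross : ∀ {u v} → Adj u v → side u ≡ true → side v ≡ false → u ≡ w × v ≡ w′
    cross {u} {v} e su sv = u≡w , d≡0⇒≡ (trans (sym dw′) (trans (cong (λ t → d t w) u≡w) (d-refl w)))
      where
      open ≤-Reasoning
      dw′ : d u w ≡ d v w′
      dw′ = ≤-antisym
        (s≤s⁻¹ (begin
          suc (d u w)  ≡⟨ sym (side-true su) ⟩
          d u w′       ≡⟨ d-sym u w′ ⟩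
          d w′ u       ≤⟨ d-adj≤ w′ (Adj-sym e) ⟩
          suc (d w′ v) ≡⟨ cong suc (d-sym w′ v) ⟩
          suc (d v w′) ∎))
        (s≤s⁻¹ (begin
          suc (d v w′) ≡⟨ sym (side-false sv) ⟩
          d v w        ≡⟨ d-sym v w ⟩
          d w v        ≤⟨ d-adj≤ w e ⟩
          suc (d w u)  ≡⟨ cong suc (d-sym w u) ⟩
          suc (d u w)  ∎))
      -- Otherwise u would have two parents towards w′: v and its parent towards w.
      u≡w : u ≡ w
      u≡w = go (d u w) refl
        where
        go : ∀ k → d u w ≡ k → u ≡ w
        go zero    eq = d≡0⇒≡ eq
        go (suc k) eq with d-step u w eq
        ... | x , f , dx = ⊥-elim (1+n≰n (begin
                  suc (suc (suc k))    ≡⟨ cong suc (trans (cong suc (sym eq)) (cong suc dw′)) ⟩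
                  suc (suc (d v w′))   ≡⟨ cong suc (sym (side-false sv)) ⟩
                  suc (d v w)          ≡⟨ cong (λ t → suc (d t w)) v≡x ⟩
                  suc (d x w)          ≡⟨ cong suc dx ⟩
                  suc k                ≤⟨ n≤1+n _ ⟩
                  suc (suc k)          ∎))
          where
          dw′u : d w′ u ≡ suc (suc k)
          dw′u = trans (d-sym w′ u) (trans (side-true su) (cong suc eq))
          v≡x : v ≡ x
          v≡x = parent-unique e f
            (begin
              d w′ v       ≡⟨ trans (d-sym w′ v) (trans (sym dw′) eq) ⟩
              suc k        ≤⟨ n≤1+n _ ⟩
              suc (suc k)  ≡⟨ sym dw′u ⟩
              d w′ u       ∎)
            (begin
              d w′ x       ≡⟨ d-sym w′ x ⟩
              d x w′       ≤⟨ d-adj≤ x centers-adjacent ⟩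
              suc (d x w)  ≡⟨ cong suc dx ⟩
              suc k        ≤⟨ n≤1+n _ ⟩
              suc (suc k)  ≡⟨ sym dw′u ⟩
              d w′ u       ∎)

    G⁻ : Graph
    G⁻ = deleteEdge G w w′

    open Walks G⁻ using () renaming (Adj to Adj⁻; Walk to Walk⁻; nil to nil⁻; snoc to snoc⁻;
      _++ʷ_ to _++⁻_; reach⇒Walk to reach⇒Walk⁻; reach-mono to reach-mono⁻; walk-preserves to walk-preserves⁻;
      module Complete to Complete⁻)

    adj⁻-same : ∀ {u v} → Adj u v → side u ≡ side v → Adj⁻ u v
    adj⁻-same {u} {v} e s rewrite e with _≟V_ G u w | _≟V_ G v w′ | _≟V_ G u w′ | _≟V_ G v w
    ... | yes refl | yes refl | _ | _ = ⊥-elim (case trans (sym side-w) (trans s side-w′) of λ ())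
    ... | _ | _ | yes refl | yes refl = ⊥-elim (case trans (sym side-w) (trans (sym s) side-w′) of λ ())
    ... | yes _ | no _ | yes _ | no _ = refl
    ... | yes _ | no _ | no _  | _    = refl
    ... | no _  | _    | yes _ | no _ = refl
    ... | no _  | _    | no _  | _    = refl

    adj⁻⇒Adj : ∀ {u v} → Adj⁻ u v → Adj u v
    adj⁻⇒Adj e = T⇒true (proj₁ (Equivalence.to T-∧ (true⇒T e)))

    ¬adj⁻-ww′ : ¬ Adj⁻ w w′
    ¬adj⁻-ww′ e with _≟V_ G w w | _≟V_ G w′ w′
    ... | yes _ | yes _ = case trans (sym e) (trans (cong (_∧ false) centers-adjacent) refl) of λ ()
    ... | no ¬p | _     = ¬p refl
    ... | _     | no ¬p = ¬p refl

    ¬adj⁻-w′w : ¬ Adj⁻ w′ w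
    ¬adj⁻-w′w e with _≟V_ G w′ w | _≟V_ G w w′ | _≟V_ G w′ w′ | _≟V_ G w w
    ... | yes p | _ | _ | _ = w≢w′ (sym p)
    ... | _ | yes p | _ | _ = w≢w′ p
    ... | no _ | no _ | yes _ | yes _ = case trans (sym e) (trans (cong (_∧ false) (Adj-sym centers-adjacent)) refl) of λ ()
    ... | _ | _ | no ¬p | _     = ¬p refl
    ... | _ | _ | _     | no ¬p = ¬p refl

    -- By `cross`, an edge that changes sides is the edge between the centres, and this one has been
    -- deleted.
    adj⁻⇒same : ∀ {u v} → Adj⁻ u v → side u ≡ side v
    adj⁻⇒same {u} {v} e with side u in su | side v in sv
    ... | true  | true  = refl
    ... | false | false = refl
    ... | true  | false with cross (adj⁻⇒Adj e) su sv
    ...   | refl , refl = ⊥-elim (¬adj⁻-ww′ e)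
    adj⁻⇒same {u} {v} e | false | true with cross (Adj-sym (adj⁻⇒Adj e)) sv su
    ...   | refl , refl = ⊥-elim (¬adj⁻-w′w e)

    -- Crossing ww′ moves away from every vertex of the side that is left.
    step-same : ∀ {k u x v} → side u ≡ side v → Adj u x → d u v ≡ suc k → d x v ≡ k → side u ≡ side x
    step-same {k} {u} {x} {v} s e du dx with side u in su | side x in sx
    ... | true  | true  = refl
    ... | false | false = refl
    ... | true  | false with cross e su sx
    ...   | refl , refl = ⊥-elim (<⇒≢ (n≤1+n (suc k)) (begin-equality
            k              ≡⟨ trans (sym dx) (d-sym w′ v) ⟩
            d v w′         ≡⟨ side-true (sym s) ⟩
            suc (d v w)    ≡⟨ cong suc (trans (d-sym v w) du) ⟩
            suc (suc k)    ∎))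
      where open ≤-Reasoning
    step-same {k} {u} {x} {v} s e du dx | false | true with cross (Adj-sym e) sx su
    ...   | refl , refl = ⊥-elim (<⇒≢ (n≤1+n (suc k)) (begin-equality
            k              ≡⟨ trans (sym dx) (d-sym w v) ⟩
            d v w          ≡⟨ side-false (sym s) ⟩
            suc (d v w′)   ≡⟨ cong suc (trans (d-sym v w′) du) ⟩
            suc (suc k)    ∎))
      where open ≤-Reasoning

    -- The geodesic itself survives the deletion. Its length is therefore at most the order, the
    -- length up to which `delta` tests reachability.
    same⇒Walk⁻ : ∀ k {u v} → side u ≡ side v → d u v ≡ k → Walk⁻ k u v
    same⇒Walk⁻ zero s eq with d≡0⇒≡ eq
    ... | refl = nil⁻
    same⇒Walk⁻ (suc k) {u} {v} s eq with d-step u v eq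
    ... | x , e , dx = subst (λ j → Walk⁻ j u v) (+-comm k 1)
            (snoc⁻ nil⁻ (adj⁻-same e sx) ++⁻ same⇒Walk⁻ k (trans (sym sx) s) dx)
      where
      sx = step-same s e eq dx

    delta-def : ∀ u v → delta G u v ≡ (if reach G⁻ (order G) u v then 0 else 1)
    delta-def u v rewrite C≡ = refl

    delta-same : ∀ {u v} → side u ≡ side v → delta G u v ≡ 0
    delta-same {u} {v} s = trans (delta-def u v) (cong (λ b → if b then 0 else 1)
      (reach-mono⁻ (dist≤order u v) (Complete⁻.Walk⇒reach complete (same⇒Walk⁻ _ s refl))))

    delta-different : ∀ {u v} → side u ≢ side v → delta G u v ≡ 1
    delta-different {u} {v} s = trans (delta-def u v) (cong (λ b → if b then 0 else 1)
      (¬-not λ r → let _ , _ , p = reach⇒Walk⁻ (order G) u v r in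
        s (sym (walk-preserves⁻ (λ x → side x ≡ side u) (λ e q → trans (sym (adj⁻⇒same e)) q) p refl))))

    home-w : ∀ {u} → side u ≡ true → Home w u
    home-w {u} s = record
      { center  = w∈
      ; nearest = ≤-antisym ≤ℓ (ℓ-lower u w∈)
      ; only    = λ c∈ e → case only-two c∈ of λ where
          (inj₁ eq)   → eq
          (inj₂ refl) → ⊥-elim (<-irrefl refl (≤-trans (≤-reflexive (sym (side-true s))) (≤-trans (≤-reflexive e) (ℓ-lower u w∈))))
      }
      where
      ≤ℓ : d u w ≤ ℓ u
      ≤ℓ with ℓ-attained u w∈
      ... | c , c∈ , eq with only-two c∈
      ...   | inj₁ refl = ≤-reflexive (sym eq)
      ...   | inj₂ refl = ≤-trans (n≤1+n _) (≤-reflexive (sym (trans eq (side-true s))))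

    home-w′ : ∀ {u} → side u ≡ false → Home w′ u
    home-w′ {u} s = record
      { center  = w′∈
      ; nearest = ≤-antisym ≤ℓ (ℓ-lower u w′∈)
      ; only    = λ c∈ e → case only-two c∈ of λ where
          (inj₂ eq)   → eq
          (inj₁ refl) → ⊥-elim (<-irrefl refl (≤-trans (≤-reflexive (sym (side-false s))) (≤-trans (≤-reflexive e) (ℓ-lower u w′∈))))
      }
      where
      ≤ℓ : d u w′ ≤ ℓ u
      ≤ℓ with ℓ-attained u w′∈
      ... | c , c∈ , eq with only-two c∈
      ...   | inj₂ refl = ≤-reflexive (sym eq)
      ...   | inj₁ refl = ≤-trans (n≤1+n _) (≤-reflexive (sym (trans eq (side-false s))))

    same-formula : ∀ {c u v} → side u ≡ side v → Home c u → Home c v →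
      d u v + 2 * phi G u v ≡ ℓ u + ℓ v + delta G u v
    same-formula s hu hv = trans (dist-same-home hu hv)
      (sym (trans (cong (ℓ _ + ℓ _ +_) (delta-same s)) (+-identityʳ _)))

    -- Seen from u, the step from w to w′ moves away and starts a geodesic to v. By `recede` the
    -- geodesic from u to v passes through w′, and the edge between the centres contributes the 1.
    opposite-formula : ∀ {u v} → side u ≡ true → side v ≡ false →
      d u v + 2 * phi G u v ≡ ℓ u + ℓ v + 1
    opposite-formula {u} {v} su sv = begin
      d u v + 2 * phi G u v  ≡⟨ cong (λ t → d u v + 2 * t) (phi-different-home hu hv w≢w′) ⟩
      d u v + 0              ≡⟨ +-identityʳ _ ⟩
      d u v                  ≡⟨ recede (d w′ v) centers-adjacent dwv refl (≤-reflexive (sym (side-true su))) ⟩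
      d u w′ + d w′ v        ≡⟨ cong₂ _+_ (side-true su) (d-sym w′ v) ⟩
      suc (d u w) + d v w′   ≡⟨ cong₂ (λ a b → suc a + b) (nearest hu) (nearest hv) ⟩
      suc (ℓ u) + ℓ v        ≡⟨ +-comm 1 (ℓ u + ℓ v) ⟩
      ℓ u + ℓ v + 1          ∎
      where
      open ≡-Reasoning
      hu  = home-w su
      hv  = home-w′ sv
      dwv : d w v ≡ suc (d w′ v)
      dwv = trans (d-sym w v) (trans (side-false sv) (cong suc (d-sym v w′)))

    phi-sym : ∀ {u v} → side u ≡ true → side v ≡ false → phi G v u ≡ phi G u v
    phi-sym su sv = trans (phi-different-home (home-w′ sv) (home-w su) (w≢w′ ∘ sym))
                          (sym (phi-different-home (home-w su) (home-w′ sv) w≢w′))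

    dist-formula : ∀ u v → d u v + 2 * phi G u v ≡ ℓ u + ℓ v + delta G u v
    dist-formula u v = go (side u) (side v) refl refl
      where
      go : ∀ a b → side u ≡ a → side v ≡ b → d u v + 2 * phi G u v ≡ ℓ u + ℓ v + delta G u v
      go true  true  su sv = same-formula (trans su (sym sv)) (home-w su) (home-w sv)
      go false false su sv = same-formula (trans su (sym sv)) (home-w′ su) (home-w′ sv)
      go true  false su sv = trans (opposite-formula su sv)
        (cong (ℓ u + ℓ v +_) (sym (delta-different (λ s → case trans (sym su) (trans s sv) of λ ()))))
      go false true  su sv = trans (cong₂ (λ a b → a + 2 * b) (d-sym u v) (phi-sym sv su))
        (trans (opposite-formula sv su) (cong₂ _+_ (+-comm (ℓ v) (ℓ u))
          (sym (delta-different (λ s → case trans (sym su) (trans s sv) of λ ())))))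

    -- Replacing w by w′ raises the distance by one on the side of w and lowers it by one on the
    -- other side. The two weights are equal, so the changes cancel.
    halves-equal : sum (map (bit ∘ side) (elems G)) ≡ sum (map (bit ∘ not ∘ side) (elems G))
    halves-equal = +-cancelˡ-≡ (weight G w) _ _ (begin
      weight G w + sum (map (bit ∘ side) (elems G))
        ≡⟨ sym (sum-+ (λ u → d u w) (bit ∘ side) (elems G)) ⟩
      sum (map (λ u → d u w + bit (side u)) (elems G))
        ≡⟨ sum-cong (elems G) pointwise ⟩
      sum (map (λ u → d u w′ + bit (not (side u))) (elems G))
        ≡⟨ sum-+ (λ u → d u w′) (bit ∘ not ∘ side) (elems G) ⟩
      weight G w′ + sum (map (bit ∘ not ∘ side) (elems G))
        ≡⟨ cong (_+ sum (map (bit ∘ not ∘ side) (elems G))) (sym weights≡) ⟩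
      weight G w + sum (map (bit ∘ not ∘ side) (elems G)) ∎)
      where
      open ≡-Reasoning
      pointwise : ∀ u → d u w + bit (side u) ≡ d u w′ + bit (not (side u))
      pointwise u with side u in s
      ... | true  = trans (+-comm (d u w) 1) (trans (sym (side-true s)) (sym (+-identityʳ _)))
      ... | false = trans (+-identityʳ _) (trans (side-false s) (+-comm 1 (d u w′)))

    halves-sum : sum (map (bit ∘ side) (elems G)) + sum (map (bit ∘ not ∘ side) (elems G)) ≡ order G
    halves-sum = trans (sym (sum-+ (bit ∘ side) (bit ∘ not ∘ side) (elems G)))
      (trans (sum-cong (elems G) one) (trans (sum-const 1 (elems G)) (*-identityʳ _)))
      where
      one : ∀ u → bit (side u) + bit (not (side u)) ≡ 1
      one u with side u
      ... | true  = refl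
      ... | false = refl

-- Trees from the edge count

index-injective : ∀ {A : Set} {x y : A} {xs} (p : x ∈ xs) (q : y ∈ xs) → index p ≡ index q → x ≡ y
index-injective {xs = xs} p q eq = trans (lookup-index p) (trans (cong (lookup xs) eq) (sym (lookup-index q)))

module FinTree (m : ℕ) (A : Fin m → Fin m → Bool) (tree : IsTree m A) where

  T₀ : Graph
  T₀ = finGraph m A

  simple : Simple T₀
  simple = proj₁ tree

  connected : Connected T₀
  connected = proj₁ (proj₂ tree)

  order≡ : order T₀ ≡ m
  order≡ = length-tabulate (λ (i : Fin m) → i)

  open Metric T₀ ∈-allFin (proj₁ simple) connected

  -- A geodesic from u to v meets a vertex at each distance 0, ..., d(u,v) from v, and these are
  -- distinct. Strictness in both factors keeps product distances within the search range of `dist`.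
  dist<order : ∀ u v → dist T₀ u v < m
  dist<order u v = injective⇒≤ {f = λ i → proj₁ (level-set (d u v) u refl (toℕ i) (s≤s⁻¹ (toℕ<n i)))}
    λ {i} {j} eq → toℕ-injective (trans (sym (at i)) (trans (cong (λ x → d x v) eq) (at j)))
    where
    level-set : ∀ k u → d u v ≡ k → ∀ i → i ≤ k → ∃[ x ] d x v ≡ i
    level-set k u eq i i≤k with i ≟ k
    ... | yes refl = u , eq
    level-set zero    u eq i i≤k | no i≢ = ⊥-elim (i≢ (n≤0⇒n≡0 i≤k))
    level-set (suc k) u eq i i≤k | no i≢ =
      let w , _ , dw = d-step u v eq in level-set k w dw i (s≤s⁻¹ (≤∧≢⇒< i≤k i≢))
    at : ∀ i → _
    at i = proj₂ (level-set (d u v) u refl (toℕ i) (s≤s⁻¹ (toℕ<n i)))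

  edges : List (Fin m × Fin m)
  edges = filterᵇ (λ (p : Fin m × Fin m) → let (u , v) = p in A u v ∧ (toℕ u <ᵇ toℕ v))
                  (cartesianProduct (allFin m) (allFin m))

  -- The representative of an edge in `edges`, where each edge is listed once, with the smaller
  -- index first.
  ordered : Fin m → Fin m → Fin m × Fin m
  ordered u v = if toℕ u <ᵇ toℕ v then (u , v) else (v , u)

  ordered∈edges : ∀ {u v} → Adj u v → ordered u v ∈ edges
  ordered∈edges {u} {v} e with toℕ u <ᵇ toℕ v in lt
  ... | true = ∈-filter⁺ (T? ∘ _) (∈-cartesianProduct⁺ (∈-allFin u) (∈-allFin v))
                 (Equivalence.from T-∧ (true⇒T e , true⇒T lt))
  ... | false = ∈-filter⁺ (T? ∘ _) (∈-cartesianProduct⁺ (∈-allFin v) (∈-allFin u))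
                 (Equivalence.from T-∧ (true⇒T (Adj-sym e) , <⇒<ᵇ (≤∧≢⇒< v≤u v≢u)))
    where
    v≤u : toℕ v ≤ toℕ u
    v≤u = ≮⇒≥ λ u<v → subst T lt (<⇒<ᵇ u<v)
    v≢u : toℕ v ≢ toℕ u
    v≢u eq with toℕ-injective eq
    ... | refl = case trans (sym e) (proj₂ simple u) of λ ()

  ordered-injective : ∀ {a b c e} → ordered a b ≡ ordered c e → (a ≡ c × b ≡ e) ⊎ (a ≡ e × b ≡ c)
  ordered-injective {a} {b} {c} {e} eq with toℕ a <ᵇ toℕ b | toℕ c <ᵇ toℕ e
  ... | true  | true  = inj₁ (,-injective eq)
  ... | true  | false = inj₂ (,-injective eq)
  ... | false | true  = let p , q = ,-injective eq in inj₂ (q , p)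
  ... | false | false = let p , q = ,-injective eq in inj₁ (q , p)

  module _ (r : Fin m) where

    step-up : ∀ u → u ≡ r ⊎ (∃[ w ] Adj u w × d r u ≡ suc (d r w))
    step-up u = go (d u r) refl
      where
      go : ∀ k → d u r ≡ k → u ≡ r ⊎ (∃[ w ] Adj u w × d r u ≡ suc (d r w))
      go zero    eq = inj₁ (d≡0⇒≡ eq)
      go (suc k) eq with d-step u r eq
      ... | w , e , dw = inj₂ (w , e , trans (d-sym r u) (trans eq (cong suc (trans (sym dw) (d-sym w r)))))

    -- The value `r` at the root is a placeholder, excluded by `parent-spec`.
    parent : Fin m → Fin m
    parent u with step-up u
    ... | inj₁ _       = r
    ... | inj₂ (w , _) = w

    parent-spec : ∀ {u} → u ≢ r → Adj u (parent u) × d r u ≡ suc (d r (parent u))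
    parent-spec {u} u≢r with step-up u
    ... | inj₁ u≡r            = ⊥-elim (u≢r u≡r)
    ... | inj₂ (w , e , down) = e , down

    -- A further edge at v that does not lead away from r, together with the m − 1
    -- edges to parents, would make m edges.
    only-parent : ∀ {v c} → v ≢ r → Adj v c → d r c ≤ d r v → c ≡ parent v
    only-parent {v} {c} v≢r e c≤v with c F.≟ parent v
    ... | yes eq = eq
    ... | no c≢  = ⊥-elim (1+n≰n (≤-trans (≤-reflexive (trans (+-comm 1 (edgeCount m A)) (proj₂ (proj₂ tree))))
                      (injective⇒≤ {f = λ u → index (∈E u)} λ {i} {j} → inj i j)))
      where
      -- The root has no parent edge, so its slot is free for the extra edge; all m vertices then
      -- index an edge.
      other : Fin m → Fin m × Fin m
      other u with u F.≟ r
      ... | yes _ = v , c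
      ... | no  _ = u , parent u
      other-adj : ∀ u → Adj (proj₁ (other u)) (proj₂ (other u))
      other-adj u with u F.≟ r
      ... | yes _  = e
      ... | no u≢r = proj₁ (parent-spec u≢r)
      ∈E : ∀ u → ordered (proj₁ (other u)) (proj₂ (other u)) ∈ edges
      ∈E u = ordered∈edges (other-adj u)
      below : ∀ {u} → u ≢ r → d r (parent u) < d r u
      below u≢r = ≤-reflexive (sym (proj₂ (parent-spec u≢r)))
      -- The extra edge cannot be a parent edge: in the same direction c would be the parent of v,
      -- and in the reverse direction c would be farther from the root than v.
      clash : ∀ {u} → u ≢ r → (v ≡ u × c ≡ parent u) ⊎ (v ≡ parent u × c ≡ u) → ⊥
      clash u≢r (inj₁ (refl , eq)) = c≢ eq
      clash u≢r (inj₂ (refl , refl)) = <⇒≱ (below u≢r) c≤v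
      inj : ∀ i j → index (∈E i) ≡ index (∈E j) → i ≡ j
      inj i j eq = same (ordered-injective {proj₁ (other i)} {proj₂ (other i)} {proj₁ (other j)} {proj₂ (other j)}
                          (index-injective (∈E i) (∈E j) eq))
        where
        same : (proj₁ (other i) ≡ proj₁ (other j) × proj₂ (other i) ≡ proj₂ (other j)) ⊎
               (proj₁ (other i) ≡ proj₂ (other j) × proj₂ (other i) ≡ proj₁ (other j)) → i ≡ j
        same with i F.≟ r | j F.≟ r
        ... | yes refl | yes refl = λ _ → refl
        ... | yes refl | no j≢r   = λ h → ⊥-elim (clash j≢r h)
        ... | no i≢r   | yes refl = λ where
              (inj₁ (p , q)) → ⊥-elim (clash i≢r (inj₁ (sym p , sym q)))
              (inj₂ (p , q)) → ⊥-elim (clash i≢r (inj₂ (sym q , sym p)))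
        ... | no i≢r   | no j≢r = λ where
              (inj₁ (p , _)) → p
              (inj₂ (p , q)) → ⊥-elim (<-asym (subst (λ t → d r t < d r i) q (below i≢r))
                                              (subst (λ t → d r t < d r j) (sym p) (below j≢r)))

  parent-unique : ParentUnique T₀
  parent-unique {r} {v} {a} e f a≤v b≤v with v F.≟ r
  ... | no v≢r = trans (only-parent r v≢r e a≤v) (sym (only-parent r v≢r f b≤v))
  -- At the root itself a neighbour at distance at most 0 would be a loop.
  ... | yes refl with d≡0⇒≡ {v} {a} (n≤0⇒n≡0 (≤-trans a≤v (≤-reflexive (d-refl v))))
  ...   | refl = case trans (sym e) (proj₂ simple v) of λ ()

-- Cartesian products

module Diameter (G : Graph) (complete : ∀ v → v ∈ elems G) where

  diam-upper : ∀ u v → dist G u v ≤ diam G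
  diam-upper u v = maxL-upper (∈-concatMap⁺ _ (lose (complete u) (∈-map⁺ (dist G u) (complete v))))

  -- `maxL` may return its default 0 without attaining it in the list; the pair (u₀, u₀) realises
  -- that value.
  diam-attained : ∀ {u₀} → dist G u₀ u₀ ≡ 0 → ∃[ u ] ∃[ v ] dist G u v ≡ diam G
  diam-attained {u₀} eq₀ with maxL-attained (concatMap (λ u → map (dist G u) (elems G)) (elems G))
  ... | inj₁ eq = u₀ , u₀ , trans eq₀ (sym eq)
  ... | inj₂ m∈ with find (∈-concatMap⁻ (λ u → map (dist G u) (elems G)) {xs = elems G} m∈)
  ...   | u , _ , m∈u with ∈-map⁻ (dist G u) m∈u
  ...     | v , _ , eq = u , v , sym eq

module ProductDistance (T₁ T₂ : Graph)
    (complete₁ : ∀ v → v ∈ elems T₁) (complete₂ : ∀ v → v ∈ elems T₂) where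

  G : Graph
  G = T₁ □ T₂

  complete : ∀ v → v ∈ elems G
  complete (x , y) = ∈-cartesianProduct⁺ (complete₁ x) (complete₂ y)

  private
    module W₁ = Walks T₁
    module W₂ = Walks T₂
    module W  = Walks G

  Adj⁻ : ∀ {x y x′ y′} → W.Adj (x , y) (x′ , y′) → (W₁.Adj x x′ × y ≡ y′) ⊎ (x ≡ x′ × W₂.Adj y y′)
  Adj⁻ {x} {y} {x′} {y′} e with Equivalence.to T-∨ (true⇒T e)
  ... | inj₁ t = let a , b = Equivalence.to T-∧ t in inj₁ (T⇒true a , toWitness {a? = _≟V_ T₂ y y′} b)
  ... | inj₂ t = let a , b = Equivalence.to T-∧ t in inj₂ (toWitness {a? = _≟V_ T₁ x x′} a , T⇒true b)

  Adj₁ : ∀ {x x′} y → W₁.Adj x x′ → W.Adj (x , y) (x′ , y)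
  Adj₁ y e = T⇒true (Equivalence.from T-∨ (inj₁ (Equivalence.from T-∧
    (true⇒T e , fromWitness {a? = _≟V_ T₂ y y} refl))))

  Adj₂ : ∀ x {y y′} → W₂.Adj y y′ → W.Adj (x , y) (x , y′)
  Adj₂ x e = T⇒true (Equivalence.from T-∨ (inj₂ (Equivalence.from T-∧
    (fromWitness {a? = _≟V_ T₁ x x} refl , true⇒T e))))

  walk₁ : ∀ {k x x′} y → W₁.Walk k x x′ → W.Walk k (x , y) (x′ , y)
  walk₁ y W₁.nil        = W.nil
  walk₁ y (W₁.snoc p e) = W.snoc (walk₁ y p) (Adj₁ y e)

  walk₂ : ∀ {k y y′} x → W₂.Walk k y y′ → W.Walk k (x , y) (x , y′)
  walk₂ x W₂.nil        = W.nil
  walk₂ x (W₂.snoc p e) = W.snoc (walk₂ x p) (Adj₂ x e)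

  -- Each edge of the product moves exactly one coordinate, so the steps are divided between the two
  -- projections.
  split : ∀ {k u v} → W.Walk k u v →
    ∃[ i ] ∃[ j ] i + j ≡ k × W₁.Walk i (proj₁ u) (proj₁ v) × W₂.Walk j (proj₂ u) (proj₂ v)
  split W.nil = 0 , 0 , refl , W₁.nil , W₂.nil
  split (W.snoc p e) with split p | Adj⁻ e
  ... | i , j , eq , p₁ , p₂ | inj₁ (e₁ , refl) = suc i , j , cong suc eq , W₁.snoc p₁ e₁ , p₂
  ... | i , j , eq , p₁ , p₂ | inj₂ (refl , e₂) = i , suc j , trans (+-suc i j) (cong suc eq) , p₁ , W₂.snoc p₂ e₂

  -- Geodesics of the factors run one after the other give ≤, and `split` applied to a shortest walk
  -- gives ≥. `bound` is needed because `dist` searches only up to the order of the product.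
  dist-product : (∀ x x′ → W₁.Walk (dist T₁ x x′) x x′) → (∀ y y′ → W₂.Walk (dist T₂ y y′) y y′) →
    (∀ x x′ y y′ → dist T₁ x x′ + dist T₂ y y′ ≤ order G) →
    ∀ x y x′ y′ → dist G (x , y) (x′ , y′) ≡ dist T₁ x x′ + dist T₂ y y′
  dist-product geo₁ geo₂ bound x y x′ y′ = ≤-antisym (W.Complete.dist-minimal complete p) lower
    where
    p : W.Walk (dist T₁ x x′ + dist T₂ y y′) (x , y) (x′ , y′)
    p = subst (λ k → W.Walk k (x , y) (x′ , y′)) (+-comm (dist T₂ y y′) (dist T₁ x x′))
          (walk₁ y (geo₁ x x′) W.++ʷ walk₂ x′ (geo₂ y y′))
    lower : dist T₁ x x′ + dist T₂ y y′ ≤ dist G (x , y) (x′ , y′)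
    lower with split (W.Complete.dist-attained complete p (bound x x′ y y′))
    ... | i , j , eq , p₁ , p₂ = ≤-trans
      (+-mono-≤ (W₁.Complete.dist-minimal complete₁ p₁) (W₂.Complete.dist-minimal complete₂ p₂)) (≤-reflexive eq)

length-cartesianProduct : ∀ {A B : Set} (xs : List A) (ys : List B) →
  length (cartesianProduct xs ys) ≡ length xs * length ys
length-cartesianProduct []       ys = refl
length-cartesianProduct (x ∷ xs) ys = trans (length-++ (map (x ,_) ys))
  (cong₂ _+_ (length-map (x ,_) ys) (length-cartesianProduct xs ys))

sum-cartesianProduct : ∀ {A B : Set} (f : A × B → ℕ) (xs : List A) (ys : List B) →
  sum (map f (cartesianProduct xs ys)) ≡ sum (map (λ x → sum (map (λ y → f (x , y)) ys)) xs)
sum-cartesianProduct f []       ys = refl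
sum-cartesianProduct f (x ∷ xs) ys =
  trans (cong sum (map-++ f (map (x ,_) ys) (cartesianProduct xs ys)))
  (trans (sum-++ (map f (map (x ,_) ys)) _)
  (cong₂ _+_ (cong sum (sym (map-∘ ys))) (sum-cartesianProduct f xs ys)))

suc-*-≥ : ∀ {a b m n} → a < m → b < n → a + b ≤ m * n
suc-*-≥ {a} {b} {suc m} {suc n} a<m b<n = begin
  a + b             ≤⟨ +-mono-≤ (s≤s⁻¹ a<m) (s≤s⁻¹ b<n) ⟩
  m + n             ≤⟨ +-monoˡ-≤ n (m≤m*n m (suc n)) ⟩
  m * suc n + n     ≡⟨ +-comm (m * suc n) n ⟩
  n + m * suc n     ≤⟨ n≤1+n _ ⟩
  suc m * suc n     ∎
  where open ≤-Reasoning

module ProductTree {m n A₁ A₂} (tree₁ : IsTree m A₁) (tree₂ : IsTree n A₂) where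

  private
    module F₁ = FinTree m A₁ tree₁
    module F₂ = FinTree n A₂ tree₂
  T₁ = finGraph m A₁
  T₂ = finGraph n A₂

  open ProductDistance T₁ T₂ ∈-allFin ∈-allFin public using (G; complete)
  private
    module PD = ProductDistance T₁ T₂ ∈-allFin ∈-allFin
    module M₁ = Metric T₁ ∈-allFin (proj₁ F₁.simple) F₁.connected
    module M₂ = Metric T₂ ∈-allFin (proj₁ F₂.simple) F₂.connected

  order≡ : order G ≡ m * n
  order≡ = trans (length-cartesianProduct (allFin m) (allFin n)) (cong₂ _*_ F₁.order≡ F₂.order≡)

  dist≡ : ∀ x y x′ y′ → dist G (x , y) (x′ , y′) ≡ dist T₁ x x′ + dist T₂ y y′
  dist≡ = PD.dist-product M₁.geodesic M₂.geodesic λ x x′ y y′ →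
    ≤-trans (suc-*-≥ (F₁.dist<order x x′) (F₂.dist<order y y′)) (≤-reflexive (sym order≡))

  dist-refl : ∀ u → dist G u u ≡ 0
  dist-refl (x , y) = trans (dist≡ x y x y) (cong₂ _+_ (M₁.d-refl x) (M₂.d-refl y))

  dist-sym : ∀ u v → dist G u v ≡ dist G v u
  dist-sym (x , y) (x′ , y′) = trans (dist≡ x y x′ y′)
    (trans (cong₂ _+_ (M₁.d-sym x x′) (M₂.d-sym y y′)) (sym (dist≡ x′ y′ x y)))

  dist≤ : ∀ u v → dist G u v ≤ diam T₁ + diam T₂
  dist≤ (x , y) (x′ , y′) = ≤-trans (≤-reflexive (dist≡ x y x′ y′))
    (+-mono-≤ (Diameter.diam-upper T₁ ∈-allFin x x′) (Diameter.diam-upper T₂ ∈-allFin y y′))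

  diam≡ : V G → diam G ≡ diam T₁ + diam T₂
  diam≡ u₀@(x₀ , y₀) = ≤-antisym upper lower
    where
    upper : diam G ≤ diam T₁ + diam T₂
    upper with Diameter.diam-attained G complete (dist-refl u₀)
    ... | u , v , eq = subst (_≤ diam T₁ + diam T₂) eq (dist≤ u v)
    lower : diam T₁ + diam T₂ ≤ diam G
    lower with Diameter.diam-attained T₁ ∈-allFin (M₁.d-refl x₀) | Diameter.diam-attained T₂ ∈-allFin (M₂.d-refl y₀)
    ... | x , x′ , eq₁ | y , y′ , eq₂ = ≤-trans (≤-reflexive (trans (sym (cong₂ _+_ eq₁ eq₂)) (sym (dist≡ x y x′ y′))))
          (Diameter.diam-upper G complete (x , y) (x′ , y′))

  -- Each vertex of `T₁` occurs in n pairs and each vertex of `T₂` in m, hence the coefficients in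
  -- the stated radio numbers.
  totalLz : sum (map (Prod.Lz T₁ T₂) (elems G)) ≡ n * totalLevel T₁ + m * totalLevel T₂
  totalLz = begin
    sum (map Lz (elems G))
      ≡⟨ sum-cartesianProduct Lz (allFin m) (allFin n) ⟩
    sum (map (λ x → sum (map (λ y → level T₁ x + level T₂ y) (allFin n))) (allFin m))
      ≡⟨ sum-cong (allFin m) row ⟩
    sum (map (λ x → n * level T₁ x + totalLevel T₂) (allFin m))
      ≡⟨ sum-+ (λ x → n * level T₁ x) (λ _ → totalLevel T₂) (allFin m) ⟩
    _
      ≡⟨ cong₂ _+_ (sum-* n (level T₁) (allFin m)) (trans (sum-const (totalLevel T₂) (allFin m)) (cong (_* totalLevel T₂) F₁.order≡)) ⟩
    n * totalLevel T₁ + m * totalLevel T₂ ∎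
    where
    open ≡-Reasoning
    Lz = Prod.Lz T₁ T₂
    row : ∀ x → sum (map (λ y → level T₁ x + level T₂ y) (allFin n)) ≡ n * level T₁ x + totalLevel T₂
    row x = trans (sum-+ (λ _ → level T₁ x) (level T₂) (allFin n))
      (cong (_+ totalLevel T₂) (trans (sum-const (level T₁ x) (allFin n)) (cong (_* level T₁ x) F₂.order≡)))

-- Orderings of the vertices

module Sums (T₁ T₂ : Graph) where

  open Prod T₁ T₂ using (sumFrom)

  sumFrom-cong : ∀ a k {f g} → (∀ t → t < a + k → f t ≡ g t) → sumFrom a k f ≡ sumFrom a k g
  sumFrom-cong a zero    h = refl
  sumFrom-cong a (suc k) h = cong₂ _+_ (h a (m<m+n a (s≤s z≤n)))
    (sumFrom-cong (suc a) k λ t lt → h t (<-≤-trans lt (≤-reflexive (sym (+-suc a k)))))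

  sumFrom-mono : ∀ a k {f g} → (∀ t → t < a + k → f t ≤ g t) → sumFrom a k f ≤ sumFrom a k g
  sumFrom-mono a zero    h = z≤n
  sumFrom-mono a (suc k) h = +-mono-≤ (h a (m<m+n a (s≤s z≤n)))
    (sumFrom-mono (suc a) k λ t lt → h t (<-≤-trans lt (≤-reflexive (sym (+-suc a k)))))

  sumFrom-+ : ∀ a k f g → sumFrom a k (λ t → f t + g t) ≡ sumFrom a k f + sumFrom a k g
  sumFrom-+ a zero    f g = refl
  sumFrom-+ a (suc k) f g = trans (cong (f a + g a +_) (sumFrom-+ (suc a) k f g)) (interchange (f a) (g a) _ _)
    where
    interchange : ∀ a b c e → a + b + (c + e) ≡ a + c + (b + e)
    interchange = solve-∀

  sumFrom-const : ∀ a k c → sumFrom a k (λ _ → c) ≡ k * c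
  sumFrom-const a zero    c = refl
  sumFrom-const a (suc k) c = cong (c +_) (sumFrom-const (suc a) k c)

  sumFrom-shift : ∀ a k f → sumFrom (suc a) k f ≡ sumFrom a k (f ∘ suc)
  sumFrom-shift a zero    f = refl
  sumFrom-shift a (suc k) f = cong (f (suc a) +_) (sumFrom-shift (suc a) k f)

  sumFrom-last : ∀ a k f → sumFrom a (suc k) f ≡ sumFrom a k f + f (a + k)
  sumFrom-last a zero    f = trans (+-identityʳ (f a)) (cong f (sym (+-identityʳ a)))
  sumFrom-last a (suc k) f = begin
    f a + sumFrom (suc a) (suc k) f              ≡⟨ cong (f a +_) (sumFrom-last (suc a) k f) ⟩
    f a + (sumFrom (suc a) k f + f (suc a + k))  ≡⟨ sym (+-assoc (f a) _ _) ⟩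
    f a + sumFrom (suc a) k f + f (suc a + k)    ≡⟨ cong (λ t → f a + sumFrom (suc a) k f + f t) (sym (+-suc a k)) ⟩
    f a + sumFrom (suc a) k f + f (a + suc k)    ∎
    where open ≡-Reasoning

  term≤sumFrom : ∀ k f {t} → t < k → f t ≤ sumFrom 0 k f
  term≤sumFrom (suc k) f {t} t<k with t ≟ k
  ... | yes refl = ≤-trans (m≤n+m (f t) (sumFrom 0 k f)) (≤-reflexive (sym (sumFrom-last 0 k f)))
  ... | no t≢k = ≤-trans (term≤sumFrom k f (≤∧≢⇒< (s≤s⁻¹ t<k) t≢k))
                   (≤-trans (m≤m+n _ (f k)) (≤-reflexive (sym (sumFrom-last 0 k f))))

  sum-applyUpTo : ∀ {X : Set} (g : X → ℕ) z k → sum (map g (applyUpTo z k)) ≡ sumFrom 0 k (g ∘ z)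
  sum-applyUpTo g z zero    = refl
  sum-applyUpTo g z (suc k) = cong (g (z 0) +_) (trans (sum-applyUpTo g (z ∘ suc) k) (sym (sumFrom-shift 0 k (g ∘ z))))

  telescope-≤ : ∀ a k {F e : ℕ → ℕ} {c} → (∀ t → t < a + k → F t + c ≤ F (suc t) + e t) →
    F a + k * c ≤ F (a + k) + sumFrom a k e
  telescope-≤ a zero {F} h = ≤-reflexive (cong (λ t → F t + 0) (sym (+-identityʳ a)))
  telescope-≤ a (suc k) {F} {e} {c} h = linear
    (+-mono-≤ (h a (m<m+n a (s≤s z≤n)))
              (telescope-≤ (suc a) k {F} {e} {c} λ t lt → h t (<-≤-trans lt (≤-reflexive (sym (+-suc a k))))))
    (trans (arith (F a) c (k * c) (F (suc a)) (e a) (F (suc a + k)) (sumFrom (suc a) k e))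
           (cong (λ t → F a + c + (F (suc a) + k * c) + (F t + (e a + sumFrom (suc a) k e))) (sym (+-suc a k))))
    where
    arith : ∀ Fa c kc F′ e Fb s → Fa + (c + kc) + (F′ + e + (Fb + s)) ≡ Fa + c + (F′ + kc) + (Fb + (e + s))
    arith = solve-∀

  telescope-≡ : ∀ a k {F e : ℕ → ℕ} {c} → (∀ t → t < a + k → F t + c ≡ F (suc t) + e t) →
    F a + k * c ≡ F (a + k) + sumFrom a k e
  telescope-≡ a zero {F} h = cong (λ t → F t + 0) (sym (+-identityʳ a))
  telescope-≡ a (suc k) {F} {e} {c} h = +-cancelˡ-≡ (F (suc a)) _ _ (begin
    F (suc a) + (F a + (c + k * c))           ≡⟨ arith₁ (F (suc a)) (F a) c (k * c) ⟩
    (F a + c) + (F (suc a) + k * c)           ≡⟨ cong₂ _+_ (h a (m<m+n a (s≤s z≤n)))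
       (telescope-≡ (suc a) k {F} {e} {c} λ t lt → h t (<-≤-trans lt (≤-reflexive (sym (+-suc a k))))) ⟩
    F (suc a) + e a + (F (suc a + k) + sumFrom (suc a) k e)
      ≡⟨ arith₂ (F (suc a)) (e a) (F (suc a + k)) (sumFrom (suc a) k e) ⟩
    F (suc a) + (F (suc a + k) + (e a + sumFrom (suc a) k e))
      ≡⟨ cong (λ t → F (suc a) + (F t + (e a + sumFrom (suc a) k e))) (sym (+-suc a k)) ⟩
    F (suc a) + (F (a + suc k) + (e a + sumFrom (suc a) k e)) ∎)
    where
    open ≡-Reasoning
    arith₁ : ∀ F′ Fa c kc → F′ + (Fa + (c + kc)) ≡ Fa + c + (F′ + kc)
    arith₁ = solve-∀
    arith₂ : ∀ F′ e Fb s → F′ + e + (Fb + s) ≡ F′ + (Fb + (e + s))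
    arith₂ = solve-∀

  -- The second hypothesis reverses the telescoped sum of the first, so no step has slack. The last
  -- step is split off: tightness of the whole forces tightness of it and of the remaining sum.
  telescope-tight : ∀ k {F e : ℕ → ℕ} {c} → (∀ t → t < k → F t + c ≤ F (suc t) + e t) →
    F k + sumFrom 0 k e ≤ F 0 + k * c → ∀ t → t < k → F t + c ≡ F (suc t) + e t
  telescope-tight (suc k) {F} {e} {c} h total t t<k = by-cases (t ≟ k)
    where
    open ≤-Reasoning
    total′ : F (suc k) + (sumFrom 0 k e + e k) ≤ F 0 + (c + k * c)
    total′ = subst (λ s → F (suc k) + s ≤ F 0 + suc k * c) (sumFrom-last 0 k e) total
    first : F 0 + k * c ≤ F k + sumFrom 0 k e
    first = telescope-≤ 0 k {F} {e} {c} (λ s lt → h s (m≤n⇒m≤1+n lt))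
    arith₁ : ∀ F′ S e F₀ c kc Fk → F′ + e + (F₀ + (c + kc) + (Fk + S)) ≡ F′ + (S + e) + (F₀ + kc) + (Fk + c)
    arith₁ = solve-∀
    arith₂ : ∀ F′ S e F₀ c kc Fk → Fk + S + (F₀ + (c + kc) + (F′ + e)) ≡ F′ + (S + e) + (Fk + c) + (F₀ + kc)
    arith₂ = solve-∀
    by-cases : Dec (t ≡ k) → F t + c ≡ F (suc t) + e t
    by-cases (yes refl) = ≤-antisym (h t t<k)
      (linear (+-mono-≤ total′ first) (arith₁ (F (suc k)) (sumFrom 0 k e) (e k) (F 0) c (k * c) (F k)))
    by-cases (no t≢k) = telescope-tight k {F} {e} {c} (λ s lt → h s (m≤n⇒m≤1+n lt))
      (linear (+-mono-≤ total′ (h k ≤-refl)) (arith₂ (F (suc k)) (sumFrom 0 k e) (e k) (F 0) c (k * c) (F k)))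
      t (≤∧≢⇒< (s≤s⁻¹ t<k) t≢k)

-- Enumerations of a finite set, and sorting by labels

module _ {X : Set} where

  Enumerates : ℕ → (ℕ → X) → Set
  Enumerates p z = (∀ v → ∃ λ t → t < p × z t ≡ v) × (∀ s t → s < p → t < p → z s ≡ z t → s ≡ t)

  module _ (xs : List X) (unique : Unique xs) (complete : ∀ v → v ∈ xs) where

    -- Two lists without repetitions and with the same members are permutations of each other. This
    -- turns sums along an ordering into sums over `elems`.
    applyUpTo-↭ : ∀ {p z} → Enumerates p z → applyUpTo z p ↭ xs
    applyUpTo-↭ {p} {z} (surjective , injective) = ∼bag⇒↭ (unique∧set⇒bag
      (Uniqueₚ.applyUpTo⁺₁ z p λ i<j j<p eq → <⇒≢ i<j (injective _ _ (<-trans i<j j<p) j<p eq))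
      unique
      (mk⇔ (λ _ → complete _) λ _ → let t , t<p , eq = surjective _ in subst (_∈ applyUpTo z p) eq (∈-applyUpTo⁺ z t<p)))

    module _ (x₀ : X) (f : X → ℕ) where

      -- An ordering is a total function on ℕ; `x₀` fills the positions beyond the list.
      nth : List X → ℕ → X
      nth []       _       = x₀
      nth (y ∷ ys) zero    = y
      nth (y ∷ ys) (suc t) = nth ys t

      nth-∈ : ∀ {ys} t → t < length ys → nth ys t ∈ ys
      nth-∈ {y ∷ ys} zero    lt = here refl
      nth-∈ {y ∷ ys} (suc t) lt = there (nth-∈ t (s≤s⁻¹ lt))

      nth-surjective : ∀ {ys v} → v ∈ ys → ∃ λ t → t < length ys × nth ys t ≡ v
      nth-surjective (here refl) = 0 , s≤s z≤n , refl
      nth-surjective (there v∈)  = let t , lt , eq = nth-surjective v∈ in suc t , s≤s lt , eq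

      nth-injective : ∀ {ys} → Unique ys → ∀ s t → s < length ys → t < length ys → nth ys s ≡ nth ys t → s ≡ t
      nth-injective {y ∷ ys} (y≢ ∷ u) zero    zero    _  _  eq = refl
      nth-injective {y ∷ ys} (y≢ ∷ u) zero    (suc t) _  lt eq = ⊥-elim (All.lookup y≢ (nth-∈ t (s≤s⁻¹ lt)) eq)
      nth-injective {y ∷ ys} (y≢ ∷ u) (suc s) zero    lt _  eq = ⊥-elim (All.lookup y≢ (nth-∈ s (s≤s⁻¹ lt)) (sym eq))
      nth-injective {y ∷ ys} (y≢ ∷ u) (suc s) (suc t) ls lt eq = cong suc (nth-injective u s t (s≤s⁻¹ ls) (s≤s⁻¹ lt) eq)

      nth-sorted : ∀ {ys} → Linked (λ x y → f x ≤ f y) ys → ∀ t → suc t < length ys → f (nth ys t) ≤ f (nth ys (suc t))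
      nth-sorted [-]     t       (s≤s ())
      nth-sorted (p ∷ l) zero    lt = p
      nth-sorted (p ∷ l) (suc t) lt = nth-sorted l t (s≤s⁻¹ lt)

      sorted-enumeration : ∃ λ z → Enumerates (length xs) z × (∀ t → suc t < length xs → f (z t) ≤ f (z (suc t)))
      sorted-enumeration = nth ys , subst (λ p → Enumerates p (nth ys) × (∀ t → suc t < p → f (nth ys t) ≤ f (nth ys (suc t))))
        (↭-length ys↭xs)
        (((λ v → nth-surjective (∈-resp-↭ (↭-sym ys↭xs) (complete v))) ,
          nth-injective (Permₛ.Unique-resp-↭ (setoid X) (↭⇒↭ₛ (↭-sym ys↭xs)) unique)) ,
         nth-sorted (sort-↗ O xs))
        where
        O = On.decTotalOrder ≤-decTotalOrder f
        ys = sort O xs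
        ys↭xs = sort-↭ O xs

-- The span of a radio labeling

-- The estimates behind the lower bound, added up, leave no slack when the bound is attained. `F₀`
-- and `FP` are the end labels, `M` is P(d+1), `D`, `Φ`, `δ` are the sums of distances, φ and δ, `S`
-- is the span, `E` the sum of the end levels, and `Λ` stands here for twice the total level. The
-- last component is the hypothesis of `telescope-tight`.
tight : ∀ {F₀ FP M D S Φ E Λ δ Δ e} →
  F₀ + M ≤ FP + D → FP ≤ F₀ + S → D + 2 * Φ + E ≡ Λ + δ → e ≤ E → δ ≤ Δ → M + e ≡ S + (Λ + Δ) →
  E ≤ e × Δ ≤ δ × Φ ≤ 0 × FP + D ≤ F₀ + M
tight {F₀} {FP} {M} {D} {S} {Φ} {E} {Λ} {δ} {Δ} {e} h₁ h₂ h₃ h₄ h₅ h₆ =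
  m+n≤o⇒m≤o E (linear (+-mono-≤ (+-mono-≤ h₁ h₂) (+-mono-≤ base h₅)) (arith₁ F₀ FP M D S Φ E Λ δ Δ e)) ,
  m+n≤o⇒m≤o Δ (linear (+-mono-≤ (+-mono-≤ h₁ h₂) (+-mono-≤ base h₄)) (arith₂ F₀ FP M D S Φ E Λ δ Δ e)) ,
  m+n≤o⇒m≤o Φ (linear (+-mono-≤ (+-mono-≤ h₁ h₂) (+-mono-≤ base (+-mono-≤ h₄ h₅))) (arith₃ F₀ FP M D S Φ E Λ δ Δ e)) ,
  m+n≤o⇒m≤o (FP + D) (linear (+-mono-≤ h₂ (+-mono-≤ base (+-mono-≤ h₄ h₅))) (arith₄ F₀ FP M D S Φ E Λ δ Δ e))
  where
  base : (D + 2 * Φ + E) + (S + (Λ + Δ)) ≤ (Λ + δ) + (M + e)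
  base = ≤-reflexive (cong₂ _+_ h₃ (sym h₆))
  arith₁ : ∀ F₀ FP M D S Φ E Λ δ Δ e →
    E + 2 * Φ + ((FP + D) + (F₀ + S) + ((Λ + δ + (M + e)) + Δ)) ≡
    (F₀ + M) + FP + ((D + 2 * Φ + E + (S + (Λ + Δ))) + δ) + e
  arith₁ = solve-∀
  arith₂ : ∀ F₀ FP M D S Φ E Λ δ Δ e →
    Δ + 2 * Φ + ((FP + D) + (F₀ + S) + ((Λ + δ + (M + e)) + E)) ≡
    (F₀ + M) + FP + ((D + 2 * Φ + E + (S + (Λ + Δ))) + e) + δ
  arith₂ = solve-∀
  arith₃ : ∀ F₀ FP M D S Φ E Λ δ Δ e →
    Φ + Φ + ((FP + D) + (F₀ + S) + ((Λ + δ + (M + e)) + (E + Δ))) ≡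
    (F₀ + M) + FP + ((D + 2 * Φ + E + (S + (Λ + Δ))) + (e + δ)) + 0
  arith₃ = solve-∀
  arith₄ : ∀ F₀ FP M D S Φ E Λ δ Δ e →
    FP + D + 2 * Φ + ((F₀ + S) + ((Λ + δ + (M + e)) + (E + Δ))) ≡
    FP + ((D + 2 * Φ + E + (S + (Λ + Δ))) + (e + δ)) + (F₀ + M)
  arith₄ = solve-∀

module RadioBound (T₁ T₂ : Graph) (d P : ℕ)
    (unique : Unique (elems (T₁ □ T₂))) (complete : ∀ v → v ∈ elems (T₁ □ T₂))
    (order≡ : order (T₁ □ T₂) ≡ suc P) (diam≡ : diam (T₁ □ T₂) ≡ d)
    (dist-sym : ∀ u v → dist (T₁ □ T₂) u v ≡ dist (T₁ □ T₂) v u)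
    (dist≤d : ∀ u v → dist (T₁ □ T₂) u v ≤ d)
    (formula : ∀ u v → dist (T₁ □ T₂) u v + 2 * Prod.φz T₁ T₂ u v ≡
                       Prod.Lz T₁ T₂ u + Prod.Lz T₁ T₂ v + Prod.δz T₁ T₂ u v)
  where

  private
    G : Graph
    G = T₁ □ T₂
  open Prod T₁ T₂
  open Sums T₁ T₂

  D : VG → VG → ℕ
  D = dist G

  Λ : ℕ
  Λ = sum (map Lz (elems G))

  step : (ℕ → VG) → (VG → VG → ℕ) → ℕ → ℕ
  step z g t = g (z t) (z (suc t))

  weightOf : VG → VG → ℕ
  weightOf u v = Lz u + Lz v + δz u v

  ends : (ℕ → VG) → ℕ
  ends z = Lz (z 0) + Lz (z P)

  -- Condition (b) with the subtracted term moved to the right, so that it lives in ℕ.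
  Separated : (ℕ → VG) → Set
  Separated z = ∀ a b → a < b → b < suc P →
    sumFrom a (b ∸ a) (step z weightOf) ≤ D (z a) (z b) + (b ∸ a ∸ 1) * (d + 1)

  -- All requirements on a good ordering, with the feasibility of steps replaced by φ = 0 and the
  -- total of δ. In this form the three cases differ only in e and Δ.
  record Optimal (e Δ : ℕ) (z : ℕ → VG) : Set where
    field
      enumerates : Enumerates (suc P) z
      ends≡      : ends z ≡ e
      Σδ≡        : sumFrom 0 P (step z δz) ≡ Δ
      φ≡0        : ∀ t → t < P → step z φz t ≡ 0
      separated  : Separated z

  sum-enumerated : ∀ {z} (g : VG → ℕ) → Enumerates (suc P) z → sumFrom 0 (suc P) (g ∘ z) ≡ sum (map g (elems G))
  sum-enumerated {z} g en = trans (sym (sum-applyUpTo g z (suc P)))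
    (sum-↭ (↭-map⁺ g (applyUpTo-↭ (elems G) unique complete en)))

  -- Each level occurs in two consecutive pairs, except those of the first and last vertex, which
  -- occur in one. Adding `ends z` completes the count to 2Λ.
  Σ-dist : ∀ {z} → Enumerates (suc P) z →
    sumFrom 0 P (step z D) + 2 * sumFrom 0 P (step z φz) + ends z ≡ 2 * Λ + sumFrom 0 P (step z δz)
  Σ-dist {z} en = begin
    ΣD + 2 * Σφ + ends z
      ≡⟨ cong (_+ ends z) (arith₀ ΣD Σφ) ⟩
    ΣD + (Σφ + Σφ) + ends z
      ≡⟨ cong (_+ ends z) (sym (trans (sumFrom-+ 0 P (step z D) _) (cong (ΣD +_) (sumFrom-+ 0 P (step z φz) (step z φz))))) ⟩
    sumFrom 0 P (λ t → step z D t + (step z φz t + step z φz t)) + ends z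
      ≡⟨ cong (_+ ends z) (sumFrom-cong 0 P λ t _ → trans (sym (arith₀ (step z D t) (step z φz t))) (formula (z t) (z (suc t)))) ⟩
    sumFrom 0 P (λ t → Lz (z t) + Lz (z (suc t)) + step z δz t) + ends z
      ≡⟨ cong (_+ ends z) (trans (sumFrom-+ 0 P (λ t → Lz (z t) + Lz (z (suc t))) (step z δz))
           (cong (_+ Σδ) (sumFrom-+ 0 P (Lz ∘ z) (Lz ∘ z ∘ suc)))) ⟩
    sumFrom 0 P (Lz ∘ z) + sumFrom 0 P (Lz ∘ z ∘ suc) + Σδ + (Lz (z 0) + Lz (z P))
      ≡⟨ arith₁ (sumFrom 0 P (Lz ∘ z)) (sumFrom 0 P (Lz ∘ z ∘ suc)) Σδ (Lz (z 0)) (Lz (z P)) ⟩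
    (sumFrom 0 P (Lz ∘ z) + Lz (z P)) + (Lz (z 0) + sumFrom 0 P (Lz ∘ z ∘ suc)) + Σδ
      ≡⟨ cong (_+ Σδ) (cong₂ _+_ (trans (sym (sumFrom-last 0 P (Lz ∘ z))) (sum-enumerated Lz en))
           (trans (cong (Lz (z 0) +_) (sym (sumFrom-shift 0 P (Lz ∘ z)))) (sum-enumerated Lz en))) ⟩
    Λ + Λ + Σδ
      ≡⟨ cong (λ t → Λ + t + Σδ) (sym (+-identityʳ Λ)) ⟩
    2 * Λ + Σδ ∎
    where
    open ≡-Reasoning
    ΣD = sumFrom 0 P (step z D)
    Σφ = sumFrom 0 P (step z φz)
    Σδ = sumFrom 0 P (step z δz)
    arith₀ : ∀ a b → a + 2 * b ≡ a + (b + b)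
    arith₀ = solve-∀
    arith₁ : ∀ A B S l r → A + B + S + (l + r) ≡ (A + r) + (l + B) + S
    arith₁ = solve-∀

  -- For vertices in label order, the truncated subtraction and the absolute value become one
  -- additive inequality.
  radio-pair : ∀ f {u v} → RadioLabeling G f → u ≢ v → f u ≤ f v → f u + (d + 1) ≤ f v + D u v
  radio-pair f {u} {v} radio u≢v fu≤fv = begin
    f u + (d + 1)                    ≤⟨ +-monoʳ-≤ (f u) (m≤n+m∸n (d + 1) (D u v)) ⟩
    f u + (D u v + (d + 1 ∸ D u v))  ≤⟨ +-monoʳ-≤ (f u) (+-monoʳ-≤ (D u v) gap) ⟩
    f u + (D u v + (f v ∸ f u))      ≡⟨ cong (f u +_) (+-comm (D u v) _) ⟩
    f u + (f v ∸ f u + D u v)        ≡⟨ sym (+-assoc (f u) _ _) ⟩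
    f u + (f v ∸ f u) + D u v        ≡⟨ cong (_+ D u v) (m+[n∸m]≡n fu≤fv) ⟩
    f v + D u v                      ∎
    where
    open ≤-Reasoning
    gap : d + 1 ∸ D u v ≤ f v ∸ f u
    gap = subst₂ _≤_ (cong (λ t → t + 1 ∸ D u v) diam≡) (m≤n⇒∣m-n∣≡n∸m fu≤fv) (radio u v u≢v)

  span-upper : ∀ f u v → f v ≤ f u + span G f
  span-upper f u v = begin
    f v                  ≤⟨ maxL-upper (∈-map⁺ f (complete v)) ⟩
    M                    ≤⟨ m≤n+m∸n M m ⟩
    m + span G f         ≤⟨ +-monoˡ-≤ (span G f) (minL-lower (∈-map⁺ f (complete u))) ⟩
    f u + span G f       ∎
    where
    open ≤-Reasoning
    M = maxL (map f (elems G))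
    m = minL (map f (elems G))

  record Arranged (f : VG → ℕ) (z : ℕ → VG) : Set where
    field
      enumerates : Enumerates (suc P) z
      increasing : ∀ t → t < P → f (z t) ≤ f (z (suc t))
      gaps       : ∀ t → t < P → f (z t) + (d + 1) ≤ f (z (suc t)) + step z D t

  arrange : ∀ f → VG → RadioLabeling G f → ∃ (Arranged f)
  arrange f x₀ radio = z , record { enumerates = en ; increasing = increasing ; gaps = gaps }
    where
    sorted = sorted-enumeration (elems G) unique complete x₀ f
    z = proj₁ sorted
    en : Enumerates (suc P) z
    en = subst (λ p → Enumerates p z) order≡ (proj₁ (proj₂ sorted))
    increasing : ∀ t → t < P → f (z t) ≤ f (z (suc t))
    increasing t t<P = proj₂ (proj₂ sorted) t (<-≤-trans (s≤s t<P) (≤-reflexive (sym order≡)))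
    gaps : ∀ t → t < P → f (z t) + (d + 1) ≤ f (z (suc t)) + step z D t
    gaps t t<P = radio-pair f radio
      (λ eq → 1+n≢n (sym (proj₂ en t (suc t) (m≤n⇒m≤1+n t<P) (s≤s t<P) eq))) (increasing t t<P)

  module _ {e Δ : ℕ} (x₀ : VG)
    (ends≥ : ∀ {z} → Enumerates (suc P) z → e ≤ ends z)
    (Σδ≤   : ∀ {z} → Enumerates (suc P) z → sumFrom 0 P (step z δz) ≤ Δ) where

    span-lower : ∀ f → RadioLabeling G f → P * (d + 1) + e ≤ span G f + (2 * Λ + Δ)
    span-lower f radio with arrange f x₀ radio
    -- The nonnegative term 2Σφ remains on the left after addition and is dropped.
    ... | z , ar = m+n≤o⇒m≤o (P * (d + 1) + e) (linear
        (+-mono-≤ (+-mono-≤ (telescope-≤ 0 P {f ∘ z} {step z D} gaps) (span-upper f (z 0) (z P)))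
                  (+-mono-≤ (≤-reflexive (Σ-dist enumerates)) (+-mono-≤ (ends≥ enumerates) (Σδ≤ enumerates))))
        (arith (f (z 0)) (f (z P)) (P * (d + 1)) (sumFrom 0 P (step z D)) (span G f)
               (sumFrom 0 P (step z φz)) (ends z) Λ (sumFrom 0 P (step z δz)) Δ e))
      where
      open Arranged ar
      arith : ∀ F₀ FP M D S Φ E Λ δ Δ e →
        M + e + 2 * Φ + ((FP + D) + (F₀ + S) + ((2 * Λ + δ) + (E + Δ))) ≡
        (F₀ + M) + FP + ((D + 2 * Φ + E) + (e + δ)) + (S + (2 * Λ + Δ))
      arith = solve-∀

    -- The ordering is the one by increasing labels. By `tight`, consecutive labels differ exactly
    -- as the radio condition demands, so the radio condition of any later pair can be rewritten as
    -- a condition on the ordering alone.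
    optimal-ordering : ∀ f → RadioLabeling G f → P * (d + 1) + e ≡ span G f + (2 * Λ + Δ) → ∃ (Optimal e Δ)
    optimal-ordering f radio eq with arrange f x₀ radio
    ... | z , ar = z , record
      { enumerates = enumerates
      ; ends≡      = ≤-antisym (proj₁ all-tight) (ends≥ enumerates)
      ; Σδ≡        = ≤-antisym (Σδ≤ enumerates) (proj₁ (proj₂ all-tight))
      ; φ≡0        = φ≡0
      ; separated  = separated
      }
      where
      open Arranged ar
      all-tight = tight (telescope-≤ 0 P {f ∘ z} {step z D} gaps) (span-upper f (z 0) (z P)) (Σ-dist enumerates)
                    (ends≥ enumerates) (Σδ≤ enumerates) eq
      φ≡0 : ∀ t → t < P → step z φz t ≡ 0
      φ≡0 t t<P = n≤0⇒n≡0 (≤-trans (term≤sumFrom P (step z φz) t<P) (proj₁ (proj₂ (proj₂ all-tight))))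
      exact : ∀ t → t < P → f (z t) + (d + 1) ≡ f (z (suc t)) + step z weightOf t
      exact t t<P = trans (telescope-tight P {f ∘ z} {step z D} gaps (proj₂ (proj₂ (proj₂ all-tight))) t t<P)
        (cong (f (z (suc t)) +_) (trans (sym (trans (cong (λ i → step z D t + 2 * i) (φ≡0 t t<P)) (+-identityʳ _)))
          (formula (z t) (z (suc t)))))
      mono : ∀ a k → a + k ≤ P → f (z a) ≤ f (z (a + k))
      mono a zero    le = ≤-reflexive (cong (f ∘ z) (sym (+-identityʳ a)))
      mono a (suc k) le = ≤-trans (mono a k (≤-trans (+-monoʳ-≤ a (n≤1+n k)) le))
        (≤-trans (increasing (a + k) (≤-trans (≤-reflexive (sym (+-suc a k))) le))
                 (≤-reflexive (cong (f ∘ z) (sym (+-suc a k)))))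
      arith : ∀ S F₀ K k D Fb → S + ((F₀ + (K + k)) + (Fb + D)) ≡ (Fb + S) + (F₀ + K) + (D + k)
      arith = solve-∀
      separated : Separated z
      -- Matching on a + (b ∸ a) ≡ b replaces b by a + suc k.
      separated a b a<b b<p with b ∸ a in eqk | m+[n∸m]≡n (<⇒≤ a<b)
      ... | zero  | refl = ⊥-elim (<-irrefl (sym (+-identityʳ a)) a<b)
      -- Telescoping evaluates the label difference with k + 1 copies of d + 1. The radio condition
      -- for the pair uses up one of them, which leaves the factor b - a - 1.
      ... | suc k | refl = linear
        (+-mono-≤ (≤-reflexive (sym (telescope-≡ a (suc k) {f ∘ z} {step z weightOf}
                     (λ t lt → exact t (<-≤-trans lt (s≤s⁻¹ b<p))))))
                  (radio-pair f radio (λ e≡ → <-irrefl (proj₂ enumerates a _ (<-trans a<b b<p) b<p e≡) a<b)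
                    (mono a (suc k) (s≤s⁻¹ b<p))))
        (arith (sumFrom a (suc k) (step z weightOf)) (f (z a)) (d + 1) (k * (d + 1)) (D (z a) (z (a + suc k))) (f (z (a + suc k))))

    module FromOrdering {z} (opt : Optimal e Δ z) where
      open Optimal opt

      position : VG → ℕ
      position v = proj₁ (proj₁ enumerates v)

      position< : ∀ v → position v < suc P
      position< v = proj₁ (proj₂ (proj₁ enumerates v))

      z-position : ∀ v → z (position v) ≡ v
      z-position v = proj₂ (proj₂ (proj₁ enumerates v))

      -- The tightest labels for consecutive vertices: each gap is exactly d + 1 minus the distance.
      -- The truncated subtraction is exact, as distances are at most d.
      F : ℕ → ℕ
      F t = sumFrom 0 t (λ s → d + 1 ∸ step z D s)

      F-step : ∀ t → t < P → F t + (d + 1) ≡ F (suc t) + step z weightOf t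
      F-step t t<P = begin
        F t + (d + 1)                                  ≡⟨ cong (F t +_) (sym (m∸n+n≡m (≤-trans (dist≤d _ _) (m≤m+n d 1)))) ⟩
        F t + (d + 1 ∸ step z D t + step z D t)        ≡⟨ sym (+-assoc (F t) _ _) ⟩
        F t + (d + 1 ∸ step z D t) + step z D t        ≡⟨ cong₂ _+_ (sym (sumFrom-last 0 t (λ s → d + 1 ∸ step z D s)))
             (trans (sym (trans (cong (λ i → step z D t + 2 * i) (φ≡0 t t<P)) (+-identityʳ _))) (formula (z t) (z (suc t)))) ⟩
        F (suc t) + step z weightOf t                  ∎
        where open ≡-Reasoning

      F-mono : ∀ {s t} → s ≤ t → F s ≤ F t
      F-mono {s} {t} s≤t with s ≟ t
      ... | yes refl = ≤-refl
      F-mono {s} {zero} z≤n | no s≢ = ≤-refl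
      F-mono {s} {suc t} s≤t | no s≢ = ≤-trans (F-mono (s≤s⁻¹ (≤∧≢⇒< s≤t s≢)))
        (≤-trans (m≤m+n (F t) _) (≤-reflexive (sym (sumFrom-last 0 t (λ s → d + 1 ∸ step z D s)))))

      F-gap : ∀ a b → a < b → b < suc P → F a + (d + 1) ≤ F b + D (z a) (z b)
      F-gap a b a<b b<p with b ∸ a in eqk | m+[n∸m]≡n (<⇒≤ a<b) | separated a b a<b b<p
      ... | zero  | refl | _ = ⊥-elim (<-irrefl (sym (+-identityʳ a)) a<b)
      ... | suc k | refl | sep = linear
        (+-mono-≤ (≤-reflexive (telescope-≡ a (suc k) {F} {step z weightOf} (λ t lt → F-step t (<-≤-trans lt (s≤s⁻¹ b<p)))))
                  sep)
        (arith (F a) (d + 1) (k * (d + 1)) (F (a + suc k)) (sumFrom a (suc k) (step z weightOf)) (D (z a) (z (a + suc k))))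
        where
        arith : ∀ Fa K k Fb S D → Fa + K + ((Fb + S) + (D + k)) ≡ Fa + (K + k) + S + (Fb + D)
        arith = solve-∀

      f : VG → ℕ
      f v = F (position v)

      f-gap : ∀ {u v} → position u < position v → d + 1 ∸ D u v ≤ f v ∸ f u
      f-gap {u} {v} lt = begin
        d + 1 ∸ D u v      ≤⟨ m≤n+o⇒m∸n≤o (d + 1) (D u v) le ⟩
        f v ∸ f u          ∎
        where
        open ≤-Reasoning
        pair : f u + (d + 1) ≤ f v + D u v
        pair = subst₂ (λ a b → f u + (d + 1) ≤ f v + D a b) (z-position u) (z-position v)
                 (F-gap (position u) (position v) lt (position< v))
        le : d + 1 ≤ D u v + (f v ∸ f u)
        le = +-cancelˡ-≤ (f u) _ _ (begin
          f u + (d + 1)                  ≤⟨ pair ⟩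
          f v + D u v                    ≡⟨ cong (_+ D u v) (sym (m+[n∸m]≡n (F-mono (<⇒≤ lt)))) ⟩
          f u + (f v ∸ f u) + D u v      ≡⟨ +-assoc (f u) _ _ ⟩
          f u + (f v ∸ f u + D u v)      ≡⟨ cong (f u +_) (+-comm _ (D u v)) ⟩
          f u + (D u v + (f v ∸ f u))    ∎)

      radio : RadioLabeling G f
      radio u v u≢v = subst (λ t → t + 1 ∸ D u v ≤ ∣ f u - f v ∣) (sym diam≡) (compare (<-cmp (position u) (position v)))
        where
        compare : Tri (position u < position v) (position u ≡ position v) (position v < position u) →
          d + 1 ∸ D u v ≤ ∣ f u - f v ∣
        compare (tri< lt _ _) = ≤-trans (f-gap lt) (≤-reflexive (sym (m≤n⇒∣m-n∣≡n∸m (F-mono (<⇒≤ lt)))))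
        compare (tri≈ _ eq _) = ⊥-elim (u≢v (trans (sym (z-position u)) (trans (cong z eq) (z-position v))))
        compare (tri> _ _ gt) = ≤-trans (≤-reflexive (cong (d + 1 ∸_) (dist-sym u v)))
          (≤-trans (f-gap gt) (≤-reflexive (sym (m≤n⇒∣n-m∣≡n∸m (F-mono (<⇒≤ gt))))))

      span≤ : span G f ≤ F P
      span≤ = ≤-trans (m∸n≤m (maxL (map f (elems G))) (minL (map f (elems G)))) (maxL-least (map f (elems G)) bounded)
        where
        bounded : ∀ {k} → k ∈ map f (elems G) → k ≤ F P
        bounded k∈ with ∈-map⁻ f k∈
        ... | v , _ , refl = F-mono (s≤s⁻¹ (position< v))

      total : P * (d + 1) + e ≡ F P + (2 * Λ + Δ)
      total = +-cancelˡ-≡ ΣD _ _ (begin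
        ΣD + (P * (d + 1) + e)              ≡⟨ cong (λ i → ΣD + (i + e)) (telescope-≡ 0 P {F} {step z weightOf} F-step) ⟩
        ΣD + (F P + Σw + e)                 ≡⟨ cong₂ (λ a b → ΣD + (F P + a + b)) (sym ΣD≡Σw) (sym ends≡) ⟩
        ΣD + (F P + ΣD + ends z)            ≡⟨ arith ΣD (F P) (ends z) ⟩
        ΣD + (F P + (ΣD + 2 * 0 + ends z))  ≡⟨ cong (λ i → ΣD + (F P + (ΣD + 2 * i + ends z))) (sym Σφ≡0) ⟩
        ΣD + (F P + (ΣD + 2 * Σφ + ends z)) ≡⟨ cong (λ i → ΣD + (F P + i)) (Σ-dist enumerates) ⟩
        ΣD + (F P + (2 * Λ + Σδ))           ≡⟨ cong (λ i → ΣD + (F P + (2 * Λ + i))) Σδ≡ ⟩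
        ΣD + (F P + (2 * Λ + Δ))            ∎)
        where
        open ≡-Reasoning
        ΣD = sumFrom 0 P (step z D)
        Σφ = sumFrom 0 P (step z φz)
        Σδ = sumFrom 0 P (step z δz)
        Σw = sumFrom 0 P (step z weightOf)
        Σφ≡0 : Σφ ≡ 0
        Σφ≡0 = trans (sumFrom-cong 0 P φ≡0) (trans (sumFrom-const 0 P 0) (*-zeroʳ P))
        ΣD≡Σw : ΣD ≡ Σw
        ΣD≡Σw = sumFrom-cong 0 P λ t t<P →
          trans (sym (trans (cong (λ i → step z D t + 2 * i) (φ≡0 t t<P)) (+-identityʳ _))) (formula (z t) (z (suc t)))
        arith : ∀ s F E → s + (F + s + E) ≡ s + (F + (s + 0 + E))
        arith = solve-∀

      attains : P * (d + 1) + e ≡ span G f + (2 * Λ + Δ)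
      -- Bounding the span by the largest label is enough, since `span-lower` supplies the opposite
      -- inequality.
      attains = ≤-antisym (span-lower f radio) (begin
        span G f + (2 * Λ + Δ)  ≤⟨ +-monoˡ-≤ (2 * Λ + Δ) span≤ ⟩
        F P + (2 * Λ + Δ)       ≡⟨ sym total ⟩
        P * (d + 1) + e         ∎)
        where open ≤-Reasoning

-- Sums with termwise bounds: equality, and a deficit of one

module Saturation (T₁ T₂ : Graph) where

  open Prod T₁ T₂ using (sumFrom)
  open Sums T₁ T₂

  sumFrom≤ : ∀ k {f c} → (∀ t → t < k → f t ≤ c) → sumFrom 0 k f ≤ k * c
  sumFrom≤ k {c = c} h = ≤-trans (sumFrom-mono 0 k h) (≤-reflexive (sumFrom-const 0 k c))

  sumFrom-constant : ∀ k {f c} → (∀ t → t < k → f t ≡ c) → sumFrom 0 k f ≡ k * c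
  sumFrom-constant k {c = c} h = trans (sumFrom-cong 0 k h) (sumFrom-const 0 k c)

  saturated : ∀ k {f c} → (∀ t → t < k → f t ≤ c) → k * c ≤ sumFrom 0 k f → ∀ t → t < k → f t ≡ c
  saturated (suc k) {f} {c} h total t t<k = by-cases (t ≟ k)
    where
    total′ : c + k * c ≤ sumFrom 0 k f + f k
    total′ = ≤-trans total (≤-reflexive (sumFrom-last 0 k f))
    arith₁ : ∀ c kc S f → c + (S + f + kc) ≡ c + kc + S + f
    arith₁ = solve-∀
    arith₂ : ∀ c kc S f → kc + (S + f + c) ≡ c + kc + f + S
    arith₂ = solve-∀
    by-cases : Dec (t ≡ k) → f t ≡ c
    by-cases (yes refl) = ≤-antisym (h t t<k)
      (linear (+-mono-≤ total′ (sumFrom≤ k λ s lt → h s (m≤n⇒m≤1+n lt))) (arith₁ c (k * c) (sumFrom 0 k f) (f k)))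
    by-cases (no t≢k) = saturated k (λ s lt → h s (m≤n⇒m≤1+n lt))
      (linear (+-mono-≤ total′ (h k ≤-refl)) (arith₂ c (k * c) (sumFrom 0 k f) (f k)))
      t (≤∧≢⇒< (s≤s⁻¹ t<k) t≢k)

  -- Look at the last term. If it is maximal, the deficit lies among the earlier terms; if not, it
  -- already uses up the whole deficit, and the earlier terms are saturated.
  one-deficit : ∀ k {f c} → (∀ t → t < k → f t ≤ c) → sumFrom 0 k f + 1 ≡ k * c →
    ∃[ t₀ ] t₀ < k × f t₀ + 1 ≡ c × (∀ t → t < k → t ≢ t₀ → f t ≡ c)
  one-deficit zero h ()
  one-deficit (suc k) {f} {c} h total with m≤n⇒m<n∨m≡n (h k ≤-refl)
  ... | inj₂ fk≡c =
    let t₀ , t₀<k , deficit , rest = one-deficit k (λ s lt → h s (m≤n⇒m≤1+n lt)) total′ in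
    t₀ , m≤n⇒m≤1+n t₀<k , deficit , extend t₀ rest
    where
    arith : ∀ S c → c + (S + 1) ≡ S + c + 1
    arith = solve-∀
    total′ : sumFrom 0 k f + 1 ≡ k * c
    total′ = +-cancelˡ-≡ c _ _ (trans (arith (sumFrom 0 k f) c)
      (trans (cong (_+ 1) (trans (cong (λ i → sumFrom 0 k f + i) (sym fk≡c)) (sym (sumFrom-last 0 k f)))) total))
    extend : ∀ t₀ → (∀ t → t < k → t ≢ t₀ → f t ≡ c) → ∀ t → t < suc k → t ≢ t₀ → f t ≡ c
    extend t₀ rest t t<k t≢ with t ≟ k
    ... | yes refl = fk≡c
    ... | no t≢k   = rest t (≤∧≢⇒< (s≤s⁻¹ t<k) t≢k) t≢
  ... | inj₁ fk<c = k , ≤-refl , ≤-antisym (≤-trans (≤-reflexive (+-comm (f k) 1)) fk<c) tight-k ,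
      λ t t<k t≢k → saturated k h′ tight-rest t (≤∧≢⇒< (s≤s⁻¹ t<k) t≢k)
    where
    h′ = λ s lt → h s (m≤n⇒m≤1+n lt)
    total′ : c + k * c ≤ sumFrom 0 k f + f k + 1
    total′ = ≤-reflexive (sym (trans (cong (_+ 1) (sym (sumFrom-last 0 k f))) total))
    arith₁ : ∀ c kc S f → c + (S + f + 1 + kc) ≡ c + kc + S + (f + 1)
    arith₁ = solve-∀
    arith₂ : ∀ c kc S f → kc + (S + f + 1 + c) ≡ c + kc + suc f + S
    arith₂ = solve-∀
    tight-k : c ≤ f k + 1
    tight-k = linear (+-mono-≤ total′ (sumFrom≤ k h′)) (arith₁ c (k * c) (sumFrom 0 k f) (f k))
    tight-rest : k * c ≤ sumFrom 0 k f
    tight-rest = linear (+-mono-≤ total′ fk<c) (arith₂ c (k * c) (sumFrom 0 k f) (f k))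

  one-exception : ∀ k {f c t₀} → t₀ < k → f t₀ + 1 ≡ c → (∀ t → t < k → t ≢ t₀ → f t ≡ c) →
    sumFrom 0 k f + 1 ≡ k * c
  one-exception (suc k) {f} {c} {t₀} t₀<k deficit rest = trans (cong (_+ 1) (sumFrom-last 0 k f)) (by-cases (t₀ ≟ k))
    where
    by-cases : Dec (t₀ ≡ k) → sumFrom 0 k f + f k + 1 ≡ c + k * c
    by-cases (yes refl) = trans (+-assoc _ (f k) 1) (trans (cong₂ _+_
      (sumFrom-constant k λ t lt → rest t (m≤n⇒m≤1+n lt) (<⇒≢ lt)) deficit) (+-comm (k * c) c))
    by-cases (no t₀≢k) = trans (arith (sumFrom 0 k f) (f k)) (cong₂ _+_ (rest k ≤-refl (t₀≢k ∘ sym))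
      (one-exception k (≤∧≢⇒< (s≤s⁻¹ t₀<k) t₀≢k) deficit λ t lt → rest t (m≤n⇒m≤1+n lt)))
      where
      arith : ∀ S f → S + f + 1 ≡ f + (S + 1)
      arith = solve-∀

  -- Used to count the vertices visited before the ordering changes to the other pair of opposite
  -- sectors.
  initial-segment : ∀ k {f t₀} → t₀ < k → (∀ t → t ≤ t₀ → f t ≡ 1) → (∀ t → t₀ < t → t < k → f t ≡ 0) →
    sumFrom 0 k f ≡ suc t₀
  initial-segment (suc k) {f} {t₀} t₀<k ones zeros = trans (sumFrom-last 0 k f) (by-cases (t₀ ≟ k))
    where
    by-cases : Dec (t₀ ≡ k) → sumFrom 0 k f + f k ≡ suc t₀
    by-cases (yes refl) = trans (cong₂ _+_ (sumFrom-constant k λ t lt → ones t (<⇒≤ lt)) (ones k ≤-refl))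
      (trans (cong (_+ 1) (*-identityʳ k)) (+-comm k 1))
    by-cases (no t₀≢k) = trans (cong₂ _+_
      (initial-segment k t₀<k′ ones λ t lo hi → zeros t lo (m≤n⇒m≤1+n hi)) (zeros k t₀<k′ ≤-refl)) (+-identityʳ _)
      where
      t₀<k′ = ≤∧≢⇒< (s≤s⁻¹ t₀<k) t₀≢k

-- Weight centres of the factors and feasible steps

length≡1 : ∀ {A : Set} (xs : List A) → length xs ≡ 1 → ∃[ x ] xs ≡ x ∷ []
length≡1 (x ∷ []) _ = x , refl

length≡2 : ∀ {A : Set} (xs : List A) → length xs ≡ 2 → ∃[ x ] ∃[ y ] xs ≡ x ∷ y ∷ []
length≡2 (x ∷ y ∷ []) _ = x , y , refl

*≡2 : ∀ a b → a * b ≡ 2 → (a ≡ 1 × b ≡ 2) ⊎ (a ≡ 2 × b ≡ 1)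
*≡2 1 b eq = inj₁ (refl , trans (sym (+-identityʳ b)) eq)
*≡2 2 1 eq = inj₂ (refl , refl)
*≡2 2 (suc (suc b)) eq = ⊥-elim (1+n≰n (≤-trans (≤-trans (s≤s (s≤s (s≤s z≤n)))
  (*-monoʳ-≤ 2 (s≤s (s≤s (z≤n {b}))))) (≤-reflexive eq)))
*≡2 (suc (suc (suc a))) 0 eq = ⊥-elim (case trans (sym (*-zeroʳ a)) eq of λ ())
*≡2 (suc (suc (suc a))) (suc b) eq = ⊥-elim (1+n≰n (≤-trans (≤-trans (s≤s (s≤s (s≤s z≤n)))
  (m≤m*n (suc (suc (suc a))) (suc b))) (≤-reflexive eq)))

Fin×Fin⇒*≡suc : ∀ {m n} → Fin m → Fin n → ∃[ P ] m * n ≡ suc P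
Fin×Fin⇒*≡suc {suc m} {suc n} _ _ = n + m * suc n , refl

-- The sum 2 means that both coordinates change sides, which leaves their exclusive or unchanged. In
-- `xor-one` just one coordinate changes, which flips it.
xor-both : ∀ a a′ b b′ → bit (a xor a′) + bit (b xor b′) ≡ 2 → a xor b ≡ a′ xor b′
xor-both true  false true  false eq = refl
xor-both true  false false true  eq = refl
xor-both false true  true  false eq = refl
xor-both false true  false true  eq = refl
xor-both true  true  true  true  ()
xor-both true  true  true  false ()
xor-both true  true  false true  ()
xor-both true  true  false false ()
xor-both false false true  true  ()
xor-both false false true  false ()
xor-both false false false true  ()
xor-both false false false false ()
xor-both true  false true  true  ()
xor-both true  false false false ()
xor-both false true  true  true  ()
xor-both false true  false false ()

xor-one : ∀ a a′ b b′ → bit (a xor a′) + bit (b xor b′) ≡ 1 → a′ xor b′ ≡ not (a xor b)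
xor-one true  true  true  false eq = refl
xor-one true  true  false true  eq = refl
xor-one false false true  false eq = refl
xor-one false false false true  eq = refl
xor-one true  false true  true  eq = refl
xor-one true  false false false eq = refl
xor-one false true  true  true  eq = refl
xor-one false true  false false eq = refl
xor-one true  true  true  true  ()
xor-one true  true  false false ()
xor-one false false true  true  ()
xor-one false false false false ()
xor-one true  false true  false ()
xor-one true  false false true  ()
xor-one false true  true  false ()
xor-one false true  false true  ()

bit≤1 : ∀ b → bit b ≤ 1
bit≤1 true  = ≤-refl
bit≤1 false = z≤n

Formula : Graph → Set
Formula T = ∀ u v → dist T u v + 2 * phi T u v ≡ level T u + level T v + delta T u v

module FinTreeCenters (m : ℕ) (A : Fin m → Fin m → Bool) (tree : IsTree m A) where

  open FinTree m A tree using (T₀; simple; connected; parent-unique; order≡) public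
  open TreeCenters T₀ ∈-allFin (Uniqueₚ.allFin⁺ m) simple connected parent-unique public

  module One (nW≡1 : nW T₀ ≡ 1) where
    w : Fin m
    w = proj₁ (length≡1 (centers T₀) nW≡1)
    open OneCenter (proj₂ (length≡1 (centers T₀) nW≡1)) public

    delta≤ : ∀ u v → delta T₀ u v ≤ 0
    delta≤ u v = ≤-reflexive (delta≡0 u v)

  module Two (nW≡2 : nW T₀ ≡ 2) where
    private
      ws = length≡2 (centers T₀) nW≡2
    w w′ : Fin m
    w  = proj₁ ws
    w′ = proj₁ (proj₂ ws)
    open TwoCenters (proj₂ (proj₂ ws)) public

    delta≡ : ∀ u v → delta T₀ u v ≡ bit (side u xor side v)
    delta≡ u v with side u in su | side v in sv
    ... | true  | true  = delta-same (trans su (sym sv))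
    ... | false | false = delta-same (trans su (sym sv))
    ... | true  | false = delta-different λ s → case trans (sym su) (trans s sv) of λ ()
    ... | false | true  = delta-different λ s → case trans (sym su) (trans s sv) of λ ()

    delta≤ : ∀ u v → delta T₀ u v ≤ 1
    delta≤ u v = ≤-trans (≤-reflexive (delta≡ u v)) (bit≤1 _)

    half : ℕ
    half = sum (map (bit ∘ side) (allFin m))

    half+half : half + half ≡ m
    half+half = trans (cong (λ i → half + i) halves-equal) (trans halves-sum order≡)

    count-side : ∀ c → sum (map (λ y → bit (c xor side y)) (allFin m)) ≡ half
    count-side false = refl
    count-side true  = sym halves-equal

module Trees {m n A₁ A₂} (tree₁ : IsTree m A₁) (tree₂ : IsTree n A₂)
    (formula₁ : Formula (finGraph m A₁)) (formula₂ : Formula (finGraph n A₂))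
    (P : ℕ) (p≡ : m * n ≡ suc P) (x₀ : Fin m × Fin n) where

  open ProductTree tree₁ tree₂
  open Prod T₁ T₂
  open Saturation T₁ T₂

  d : ℕ
  d = diam T₁ + diam T₂

  order≡suc : order G ≡ suc P
  order≡suc = trans order≡ p≡

  formula : ∀ u v → dist G u v + 2 * φz u v ≡ Lz u + Lz v + δz u v
  formula (x , y) (x′ , y′) = begin
    dist G (x , y) (x′ , y′) + 2 * (φ₁ + φ₂)      ≡⟨ cong (_+ 2 * (φ₁ + φ₂)) (dist≡ x y x′ y′) ⟩
    dist T₁ x x′ + dist T₂ y y′ + 2 * (φ₁ + φ₂)   ≡⟨ arith₁ (dist T₁ x x′) (dist T₂ y y′) φ₁ φ₂ ⟩
    (dist T₁ x x′ + 2 * φ₁) + (dist T₂ y y′ + 2 * φ₂) ≡⟨ cong₂ _+_ (formula₁ x x′) (formula₂ y y′) ⟩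
    (level T₁ x + level T₁ x′ + delta T₁ x x′) + (level T₂ y + level T₂ y′ + delta T₂ y y′)
      ≡⟨ arith₂ (level T₁ x) (level T₁ x′) (delta T₁ x x′) (level T₂ y) (level T₂ y′) (delta T₂ y y′) ⟩
    level T₁ x + level T₂ y + (level T₁ x′ + level T₂ y′) + (delta T₁ x x′ + delta T₂ y y′) ∎
    where
    open ≡-Reasoning
    φ₁ = phi T₁ x x′
    φ₂ = phi T₂ y y′
    arith₁ : ∀ a b p q → a + b + 2 * (p + q) ≡ (a + 2 * p) + (b + 2 * q)
    arith₁ = solve-∀
    arith₂ : ∀ a a′ p b b′ q → (a + a′ + p) + (b + b′ + q) ≡ a + b + (a′ + b′) + (p + q)
    arith₂ = solve-∀

  elems-unique : Unique (elems G)
  elems-unique = Uniqueₚ.cartesianProduct⁺ (Uniqueₚ.allFin⁺ m) (Uniqueₚ.allFin⁺ n)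

  open RadioBound T₁ T₂ d P elems-unique complete order≡suc (diam≡ x₀) dist-sym dist≤ formula public

  Ends : ℕ → (ℕ → VG) → Set
  Ends p z = (nWG ≡ 1 → Lz (z 0) + Lz (z (p ∸ 1)) ≡ 1) × (2 ≤ nWG → Lz (z 0) + Lz (z (p ∸ 1)) ≡ 0)

  Steps : ℕ → (ℕ → VG) → Set
  Steps p z = ∀ t → suc t < p →
    ((nWG ≡ 4 × 2 * suc t ≡ p) → (φz (z t) (z (suc t)) ≡ 0) × (δz (z t) (z (suc t)) ≡ 1)) ×
    (((nWG ≡ 4 × 2 * suc t ≡ p) → ⊥) → Feasible (z t) (z (suc t)))

  -- The part of `Optimal` that corresponds to feasibility of the steps.
  Tight : ℕ → (ℕ → VG) → Set
  Tight Δ z = (∀ t → t < P → step z φz t ≡ 0) × sumFrom 0 P (step z δz) ≡ Δ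

  -- Terms bounded by ξ with total Pξ are all equal to ξ, and the exceptional middle clause is
  -- vacuous without four centres.
  steps-uniform : nWG ≢ 4 → (∀ u v → δz u v ≤ ξ) → ∀ {z} → Tight (P * ξ) z ⇔ Steps (suc P) z
  steps-uniform nWG≢4 δ≤ξ {z} = mk⇔
    (λ (φ0 , Σδ) t t<P → (λ (eq , _) → ⊥-elim (nWG≢4 eq)) ,
      λ _ → φ0 t (s≤s⁻¹ t<P) , saturated P (λ s _ → δ≤ξ _ _) (≤-reflexive (sym Σδ)) t (s≤s⁻¹ t<P))
    (λ steps → let feasible = λ t t<P → proj₂ (steps t (s≤s t<P)) (λ (eq , _) → nWG≢4 eq) in
      (λ t t<P → proj₁ (feasible t t<P)) , sumFrom-constant P λ t t<P → proj₂ (feasible t t<P))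
    where open Sums T₁ T₂

  Σδ≤-uniform : (∀ u v → δz u v ≤ ξ) → ∀ {z} → Enumerates (suc P) z → sumFrom 0 P (step z δz) ≤ P * ξ
  Σδ≤-uniform δ≤ξ _ = sumFrom≤ P λ t _ → δ≤ξ _ _

-- Four weight centres: parity classes and the middle step

module FourCenters {m n A₁ A₂} (tree₁ : IsTree m A₁) (tree₂ : IsTree n A₂)
    (nW₁ : nW (finGraph m A₁) ≡ 2) (nW₂ : nW (finGraph n A₂) ≡ 2) where

  private
    module C₁ = FinTreeCenters.Two m A₁ tree₁ nW₁
    module C₂ = FinTreeCenters.Two n A₂ tree₂ nW₂
    T₁ = finGraph m A₁
    T₂ = finGraph n A₂
  open Prod T₁ T₂
  open Saturation T₁ T₂

  half : ℕ
  half = m * C₂.half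

  half+half : half + half ≡ m * n
  half+half = trans (sym (*-distribˡ-+ m C₂.half C₂.half)) (cong (m *_) C₂.half+half)

  x₀ : VG
  x₀ = C₁.w , C₂.w

  parity : VG → Bool
  parity (x , y) = C₁.side x xor C₂.side y

  δ≡ : ∀ u v → δz u v ≡ bit (C₁.side (proj₁ u) xor C₁.side (proj₁ v)) + bit (C₂.side (proj₂ u) xor C₂.side (proj₂ v))
  δ≡ (x , y) (x′ , y′) = cong₂ _+_ (C₁.delta≡ x x′) (C₂.delta≡ y y′)

  δ≤2 : ∀ u v → δz u v ≤ 2
  δ≤2 (x , y) (x′ , y′) = +-mono-≤ (C₁.delta≤ x x′) (C₂.delta≤ y y′)

  δ≡2⇒ : ∀ {u v} → δz u v ≡ 2 → parity u ≡ parity v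
  δ≡2⇒ {x , y} {x′ , y′} eq = xor-both (C₁.side x) (C₁.side x′) (C₂.side y) (C₂.side y′) (trans (sym (δ≡ _ _)) eq)

  δ≡1⇒ : ∀ {u v} → δz u v ≡ 1 → parity v ≡ not (parity u)
  δ≡1⇒ {x , y} {x′ , y′} eq = xor-one (C₁.side x) (C₁.side x′) (C₂.side y) (C₂.side y′) (trans (sym (δ≡ _ _)) eq)

  -- Each class of `parity` is a pair of opposite sectors.
  agrees : Bool → VG → ℕ
  agrees b v = bit (not (b xor parity v))

  -- For a fixed first coordinate, a parity class is one side of the second tree, and both sides
  -- have `C₂.half` vertices. There are m such rows.
  count-parity : ∀ b → sum (map (agrees b) (elems (T₁ □ T₂))) ≡ half
  count-parity b = trans (sum-cartesianProduct (agrees b) (allFin m) (allFin n))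
    (trans (sum-cong (allFin m) row) (trans (sum-const C₂.half (allFin m))
      (cong (_* C₂.half) (FinTree.order≡ m A₁ tree₁))))
    where
    regroup : ∀ a s t → bit (not (a xor (s xor t))) ≡ bit (not (a xor s) xor t)
    regroup true  true  true  = refl
    regroup true  true  false = refl
    regroup true  false true  = refl
    regroup true  false false = refl
    regroup false true  true  = refl
    regroup false true  false = refl
    regroup false false true  = refl
    regroup false false false = refl
    row : ∀ x → sum (map (λ y → agrees b (x , y)) (allFin n)) ≡ C₂.half
    row x = trans (sum-cong (allFin n) λ y → regroup b (C₁.side x) (C₂.side y)) (C₂.count-side (not (b xor C₁.side x)))

  nWG≡4 : nWG ≡ 4
  nWG≡4 = cong₂ _*_ nW₁ nW₂

  ξ≡2 : ξ ≡ 2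
  ξ≡2 = cong₂ (λ a b → a + b ∸ 2) nW₁ nW₂

  middle : ∃[ t ] half ≡ suc t
  middle with half in eq
  ... | suc t = t , refl
  ... | zero with Fin×Fin⇒*≡suc (proj₁ x₀) (proj₂ x₀)
  ...   | P , p≡ = ⊥-elim (case trans (sym (cong₂ _+_ eq eq)) (trans half+half p≡) of λ ())

  module _ (P : ℕ) (p≡ : m * n ≡ suc P) where

    open Trees tree₁ tree₂ C₁.dist-formula C₂.dist-formula P p≡ x₀ public

    -- The step from the last vertex of the first half to the first vertex of the second; it is the
    -- t with 2(t + 1) = p.
    mid : ℕ
    mid = proj₁ middle

    2*suc-mid : 2 * suc mid ≡ suc P
    2*suc-mid = trans (cong (λ i → suc mid + i) (+-identityʳ (suc mid)))
      (trans (cong₂ _+_ (sym (proj₂ middle)) (sym (proj₂ middle))) (trans half+half p≡))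

    mid<P : mid < P
    mid<P = subst (mid <_) (suc-injective 2*suc-mid) (≤-trans (s≤s (m≤m+n mid 0)) (m≤n+m (suc (mid + 0)) mid))

    2*suc⇒mid : ∀ {t} → 2 * suc t ≡ suc P → t ≡ mid
    2*suc⇒mid eq = suc-injective (*-cancelˡ-≡ _ _ 2 (trans eq (sym 2*suc-mid)))

    Δ : ℕ
    Δ = P * 2 ∸ 1

    Δ+1 : Δ + 1 ≡ P * 2
    Δ+1 = m∸n+n≡m (≤-trans (s≤s z≤n) (≤-trans mid<P (m≤m*n P 2)))

    constant : ∀ {z} → (∀ t → t < P → step z δz t ≡ 2) → ∀ t → t < suc P → parity (z t) ≡ parity (z 0)
    constant h zero    lt = refl
    constant h (suc t) lt = trans (sym (δ≡2⇒ (h t (s≤s⁻¹ lt)))) (constant h t (≤-trans (n≤1+n _) lt))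

    Σδ≤ : ∀ {z} → Enumerates (suc P) z → sumFrom 0 P (step z δz) ≤ Δ
    Σδ≤ {z} (surjective , _) = ≮⇒≥ λ Δ<Σ →
      let all-2 = saturated P (λ t _ → δ≤2 _ _) (≤-trans (≤-reflexive (trans (sym Δ+1) (+-comm Δ 1))) Δ<Σ)
          same : ∀ v → parity v ≡ parity (z 0)
          same v = let t , t<p , eq = surjective v in trans (cong parity (sym eq)) (constant all-2 t t<p)
      in clash (trans (same x₀) (sym (same (C₁.w′ , C₂.w))))
      where
      -- The two vertices agree in the second coordinate and lie on different sides in the first, so
      -- their parities differ.
      clash : parity x₀ ≢ parity (C₁.w′ , C₂.w)
      clash eq with C₂.side C₂.w | subst₂ (λ a b → a xor C₂.side C₂.w ≡ b xor C₂.side C₂.w) C₁.side-w C₁.side-w′ eq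
      ... | true  | ()
      ... | false | ()

    -- The value Δ = 2P - 1 leaves a single step with δ = 1. Parity is constant before and after it
    -- and flips there, so the step separates the two classes; as these are equally large, it is the
    -- middle step.
    steps⇔ : ∀ {z} → Enumerates (suc P) z → Tight Δ z ⇔ Steps (suc P) z
    steps⇔ {z} en = mk⇔ to from
      where
      from : Steps (suc P) z → Tight Δ z
      from steps = φ0 , +-cancelʳ-≡ 1 _ _ (trans (one-exception P mid<P (cong (_+ 1) (proj₂ at-mid)) others) (sym Δ+1))
        where
        at-mid = proj₁ (steps mid (s≤s mid<P)) (nWG≡4 , 2*suc-mid)
        feasible : ∀ t → t < P → t ≢ mid → Feasible (z t) (z (suc t))
        feasible t t<P t≢ = proj₂ (steps t (s≤s t<P)) λ (_ , eq) → t≢ (2*suc⇒mid eq)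
        others : ∀ t → t < P → t ≢ mid → step z δz t ≡ 2
        others t t<P t≢ = trans (proj₂ (feasible t t<P t≢)) ξ≡2
        φ0 : ∀ t → t < P → step z φz t ≡ 0
        φ0 t t<P with t ≟ mid
        ... | yes refl = proj₁ at-mid
        ... | no t≢    = proj₁ (feasible t t<P t≢)
      to : Tight Δ z → Steps (suc P) z
      to (φ0 , Σδ) with one-deficit P (λ t _ → δ≤2 (z t) (z (suc t))) (trans (cong (_+ 1) Σδ) Δ+1)
      ... | t₀ , t₀<P , deficit , rest = λ t t<P →
        (λ (_ , eq) → φ0 t (s≤s⁻¹ t<P) , subst (λ i → step z δz i ≡ 1) (trans t₀≡mid (sym (2*suc⇒mid eq))) δ≡1) ,
        (λ ¬mid → φ0 t (s≤s⁻¹ t<P) , trans (rest t (s≤s⁻¹ t<P) λ eq → ¬mid (nWG≡4 ,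
            trans (cong (λ i → 2 * suc i) (trans eq t₀≡mid)) 2*suc-mid)) (sym ξ≡2))
        where
        δ≡1 : step z δz t₀ ≡ 1
        δ≡1 = +-cancelʳ-≡ 1 _ _ deficit
        before : ∀ t → t ≤ t₀ → parity (z t) ≡ parity (z 0)
        before zero    _  = refl
        before (suc t) lt = trans (sym (δ≡2⇒ (rest t (<-trans lt t₀<P) (<⇒≢ lt)))) (before t (<⇒≤ lt))
        after : ∀ t → t₀ < t → t < suc P → parity (z t) ≡ not (parity (z 0))
        after (suc t) lo hi with t ≟ t₀
        ... | yes refl = trans (δ≡1⇒ δ≡1) (cong not (before t ≤-refl))
        ... | no t≢    = trans (sym (δ≡2⇒ (rest t (s≤s⁻¹ hi) t≢)))
                           (after t (≤∧≢⇒< (s≤s⁻¹ lo) (t≢ ∘ sym)) (≤-trans (n≤1+n _) hi))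
        agree : ∀ a b → b ≡ a → bit (not (a xor b)) ≡ 1
        agree true  _ refl = refl
        agree false _ refl = refl
        disagree : ∀ a b → b ≡ not a → bit (not (a xor b)) ≡ 0
        disagree true  _ refl = refl
        disagree false _ refl = refl
        -- Vertices with the parity of `z 0` are counted twice: they occupy the positions 0, ...,
        -- t₀, and they form half of the graph.
        suc-t₀≡half : suc t₀ ≡ half
        suc-t₀≡half = trans (sym (initial-segment (suc P) (m≤n⇒m≤1+n t₀<P)
            (λ t le → agree (parity (z 0)) _ (before t le))
            (λ t lo hi → disagree (parity (z 0)) _ (after t lo hi))))
          (trans (sum-enumerated (agrees (parity (z 0))) en) (count-parity (parity (z 0))))
        t₀≡mid : t₀ ≡ mid
        t₀≡mid = suc-injective (trans suc-t₀≡half (proj₂ middle))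

-- The radio number

open import Data.Integer as ℤ using (+_; _-_)
import Data.Integer.Properties as ℤₚ
import Data.Integer.Tactic.RingSolver as ℤ-Solver

+m-n+n : ∀ i j → i - j ℤ.+ j ≡ i
+m-n+n = ℤ-Solver.solve-∀

+m+n-n : ∀ i j → i ℤ.+ j - j ≡ i
+m+n-n = ℤ-Solver.solve-∀

≡-minus⁻ : ∀ S A B → + S ≡ + A - + B → A ≡ S + B
≡-minus⁻ S A B eq = ℤₚ.+-injective (trans (sym (+m-n+n (+ A) (+ B))) (cong (ℤ._+ + B) (sym eq)))

≡-minus⁺ : ∀ S A B → A ≡ S + B → + S ≡ + A - + B
≡-minus⁺ S A B eq = sym (trans (cong (λ i → + i - + B) eq) (+m+n-n (+ S) (+ B)))

minus-≤⁻ : ∀ S A B → + A - + B ℤ.≤ + S → A ≤ S + B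
minus-≤⁻ S A B le = ℤₚ.drop‿+≤+ (subst (ℤ._≤ + (S + B)) (+m-n+n (+ A) (+ B)) (ℤₚ.+-monoˡ-≤ (+ B) le))

minus-≤⁺ : ∀ S A B → A ≤ S + B → + A - + B ℤ.≤ + S
minus-≤⁺ S A B le = subst (+ A - + B ℤ.≤_) (+m+n-n (+ S) (+ B)) (ℤₚ.+-monoˡ-≤ (ℤ.- + B) (ℤ.+≤+ le))

module RadioNumber {m n A₁ A₂} (tree₁ : IsTree m A₁) (tree₂ : IsTree n A₂)
    (formula₁ : Formula (finGraph m A₁)) (formula₂ : Formula (finGraph n A₂))
    (P : ℕ) (p≡ : m * n ≡ suc P) (x₀ : Fin m × Fin n) where

  private
    T₁ = finGraph m A₁
    T₂ = finGraph n A₂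
    G  = T₁ □ T₂
    L₁ = totalLevel T₁
    L₂ = totalLevel T₂
  open Trees tree₁ tree₂ formula₁ formula₂ P p≡ x₀
  open Prod T₁ T₂

  -- `GoodOrdering` with the number of vertices as a variable, so that `order G` can be rewritten to
  -- `suc P`.
  GoodAt : ℕ → Set
  GoodAt p = Σ (ℕ → VG) λ z →
    (∀ v → ∃ λ t → t < p × z t ≡ v) ×
    (∀ s t → s < p → t < p → z s ≡ z t → s ≡ t) ×
    Steps p z × Ends p z ×
    (∀ a b → a < b → b < p →
      (+ sumFrom a (b ∸ a) (step z weightOf)) - (+ ((b ∸ a ∸ 1) * (d + 1))) ℤ.≤ + dist G (z a) (z b))

  goodOrdering⇔ : ∀ {e Δ} →
    (∀ z → ends z ≡ e ⇔ Ends (suc P) z) →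
    (∀ {z} → Enumerates (suc P) z → Tight Δ z ⇔ Steps (suc P) z) →
    ∃ (Optimal e Δ) ⇔ GoodOrdering
  goodOrdering⇔ {e} {Δ} ends⇔ steps⇔ = mk⇔
    (λ (z , opt) → let open Optimal opt in subst GoodAt (sym order≡suc)
      (z , proj₁ enumerates , proj₂ enumerates ,
       Equivalence.to (steps⇔ enumerates) (φ≡0 , Σδ≡) , Equivalence.to (ends⇔ z) ends≡ ,
       λ a b a<b b<p → minus-≤⁺ (dist G (z a) (z b)) _ ((b ∸ a ∸ 1) * (d + 1)) (separated a b a<b b<p)))
    (λ good → from (subst GoodAt order≡suc good))
    where
    from : GoodAt (suc P) → ∃ (Optimal e Δ)
    from (z , surjective , injective , steps , ends , separated) =
      let en = surjective , injective
          φ0 , Σδ = Equivalence.from (steps⇔ en) steps in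
      z , record
        { enumerates = en
        ; ends≡      = Equivalence.from (ends⇔ z) ends
        ; Σδ≡        = Σδ
        ; φ≡0        = φ0
        ; separated  = λ a b a<b b<p → minus-≤⁻ (dist G (z a) (z b)) _ ((b ∸ a ∸ 1) * (d + 1)) (separated a b a<b b<p)
        }

  -- A labeling of span k meets the lower bound with equality and yields an ordering. Conversely the
  -- labeling built from an ordering has span k, and `span-lower` is its minimality.
  radioNumber⇔ : ∀ {e Δ k} → k ≡ + (P * (d + 1) + e) - + (2 * Λ + Δ) →
    (∀ {z} → Enumerates (suc P) z → e ≤ ends z) →
    (∀ {z} → Enumerates (suc P) z → sumFrom 0 P (step z δz) ≤ Δ) →
    RadioNumberIs G k ⇔ ∃ (Optimal e Δ)
  radioNumber⇔ {e} {Δ} refl ends≥ Σδ≤ = mk⇔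
    (λ ((f , radio , span≡) , _) →
      optimal-ordering x₀ ends≥ Σδ≤ f radio (≡-minus⁻ (span G f) _ (2 * Λ + Δ) span≡))
    (λ (z , opt) → let open FromOrdering x₀ ends≥ Σδ≤ opt in
      (f , radio , ≡-minus⁺ (span G f) _ (2 * Λ + Δ) attains) ,
      λ g radio-g → minus-≤⁺ (span G g) _ (2 * Λ + Δ) (span-lower x₀ ends≥ Σδ≤ g radio-g))

  radioNumber⇔goodOrdering : ∀ {e Δ k} → k ≡ + (P * (d + 1) + e) - + (2 * Λ + Δ) →
    (∀ {z} → Enumerates (suc P) z → e ≤ ends z) →
    (∀ {z} → Enumerates (suc P) z → sumFrom 0 P (step z δz) ≤ Δ) →
    (∀ z → ends z ≡ e ⇔ Ends (suc P) z) →
    (∀ {z} → Enumerates (suc P) z → Tight Δ z ⇔ Steps (suc P) z) →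
    RadioNumberIs G k ⇔ GoodOrdering
  radioNumber⇔goodOrdering k≡ ends≥ Σδ≤ ends⇔ steps⇔ = mk⇔
    (Equivalence.to good ∘ Equivalence.to radio) (Equivalence.from radio ∘ Equivalence.from good)
    where
    radio = radioNumber⇔ k≡ ends≥ Σδ≤
    good  = goodOrdering⇔ ends⇔ steps⇔

  ends⇔0 : 2 ≤ nWG → ∀ z → ends z ≡ 0 ⇔ Ends (suc P) z
  ends⇔0 2≤ z = mk⇔ (λ eq → (λ nWG≡1 → ⊥-elim (1+n≰n (≤-trans 2≤ (≤-reflexive nWG≡1)))) , λ _ → eq)
                    (λ (_ , h) → h 2≤)

  ends⇔1 : nWG ≡ 1 → ∀ z → ends z ≡ 1 ⇔ Ends (suc P) z
  ends⇔1 nWG≡1 z = mk⇔ (λ eq → (λ _ → eq) , λ 2≤ → ⊥-elim (1+n≰n (≤-trans 2≤ (≤-reflexive nWG≡1))))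
                       (λ (h , _) → h nWG≡1)

  +2Λ : ∀ Δ → + (2 * Λ + Δ) ≡ + (2 * n * L₁) ℤ.+ + (2 * m * L₂) ℤ.+ + Δ
  +2Λ Δ = cong (λ i → + (i + Δ)) (trans (cong (2 *_) (ProductTree.totalLz tree₁ tree₂)) (arith n L₁ m L₂))
    where
    arith : ∀ n a m b → 2 * (n * a + m * b) ≡ 2 * n * a + 2 * m * b
    arith = solve-∀

  -- Here the final + 1 is the least possible sum of the end levels.
  value₁ : ∀ {ξ} → ξ ≡ 0 → + ((m * n ∸ 1) * (d + 1)) - + (2 * n * L₁) - + (2 * m * L₂) ℤ.+ + 1 ≡
    + (P * (d + 1) + 1) - + (2 * Λ + P * ξ)
  value₁ refl = trans (cong (λ q → + ((q ∸ 1) * (d + 1)) - + (2 * n * L₁) - + (2 * m * L₂) ℤ.+ + 1) p≡)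
    (trans (arith (+ (P * (d + 1))) (+ (2 * n * L₁)) (+ (2 * m * L₂)))
      (cong (λ i → + (P * (d + 1) + 1) - i) (sym (trans (+2Λ (P * 0)) (cong (λ i → + (2 * n * L₁) ℤ.+ + (2 * m * L₂) ℤ.+ + i) (*-zeroʳ P))))))
    where
    arith : ∀ a b c → a - b - c ℤ.+ + 1 ≡ a ℤ.+ + 1 - (b ℤ.+ c ℤ.+ + 0)
    arith = ℤ-Solver.solve-∀

  -- Each of the P steps has δ = 1, which turns the factor d + 1 into d.
  value₂ : ∀ {ξ} → ξ ≡ 1 → + ((m * n ∸ 1) * d) - + (2 * n * L₁) - + (2 * m * L₂) ≡
    + (P * (d + 1) + 0) - + (2 * Λ + P * ξ)
  value₂ refl = trans (cong (λ q → + ((q ∸ 1) * d) - + (2 * n * L₁) - + (2 * m * L₂)) p≡)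
    (trans (arith (+ (P * d)) (+ P) (+ (2 * n * L₁)) (+ (2 * m * L₂)))
      (cong₂ _-_ (cong +_ (expand P d)) (sym (trans (+2Λ (P * 1)) (cong (λ i → + (2 * n * L₁) ℤ.+ + (2 * m * L₂) ℤ.+ + i) (*-identityʳ P))))))
    where
    arith : ∀ a q b c → a - b - c ≡ a ℤ.+ q - (b ℤ.+ c ℤ.+ q)
    arith = ℤ-Solver.solve-∀
    expand : ∀ P d → P * d + P ≡ P * (d + 1) + 0
    expand = solve-∀

  -- P(d+1) - (2P - 1) = P(d-1) + 1, so the final + 1 is here the price of the one step with δ = 1.
  value₃ : ∀ {Δ} → Δ + 1 ≡ P * 2 →
    (+ (m * n ∸ 1) ℤ.* (+ d - + 1)) - + (2 * n * L₁) - + (2 * m * L₂) ℤ.+ + 1 ≡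
    + (P * (d + 1) + 0) - + (2 * Λ + Δ)
  value₃ {Δ} Δ+1 = begin
    (+ (m * n ∸ 1) ℤ.* (+ d - + 1)) - b - c ℤ.+ + 1
      ≡⟨ cong (λ q → (+ (q ∸ 1) ℤ.* (+ d - + 1)) - b - c ℤ.+ + 1) p≡ ⟩
    (+ P ℤ.* (+ d - + 1)) - b - c ℤ.+ + 1
      ≡⟨ arith₁ (+ P) (+ d) b c ⟩
    (+ P ℤ.* (+ d ℤ.+ + 1)) - (b ℤ.+ c) - (+ P ℤ.* + 2) ℤ.+ + 1
      ≡⟨ cong (λ i → (+ P ℤ.* (+ d ℤ.+ + 1)) - (b ℤ.+ c) - i ℤ.+ + 1) (sym (trans (cong +_ Δ+1) (ℤₚ.pos-* P 2))) ⟩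
    (+ P ℤ.* (+ d ℤ.+ + 1)) - (b ℤ.+ c) - (+ Δ ℤ.+ + 1) ℤ.+ + 1
      ≡⟨ arith₂ (+ P ℤ.* (+ d ℤ.+ + 1)) b c (+ Δ) ⟩
    (+ P ℤ.* (+ d ℤ.+ + 1)) - (b ℤ.+ c ℤ.+ + Δ)
      ≡⟨ cong₂ _-_ (sym (trans (cong +_ (+-identityʳ (P * (d + 1)))) (ℤₚ.pos-* P (d + 1)))) (sym (+2Λ Δ)) ⟩
    + (P * (d + 1) + 0) - + (2 * Λ + Δ) ∎
    where
    open ≡-Reasoning
    b = + (2 * n * L₁)
    c = + (2 * m * L₂)
    arith₁ : ∀ q d b c → (q ℤ.* (d - + 1)) - b - c ℤ.+ + 1 ≡ (q ℤ.* (d ℤ.+ + 1)) - (b ℤ.+ c) - (q ℤ.* + 2) ℤ.+ + 1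
    arith₁ = ℤ-Solver.solve-∀
    arith₂ : ∀ a b c δ → a - (b ℤ.+ c) - (δ ℤ.+ + 1) ℤ.+ + 1 ≡ a - (b ℤ.+ c ℤ.+ δ)
    arith₂ = ℤ-Solver.solve-∀

-- On a single vertex both sides fail: the stated value is 1, and the two ends coincide.
single-vertex : ∀ (A₁ A₂ : Fin 1 → Fin 1 → Bool) →
  let T₁ = finGraph 1 A₁ ; T₂ = finGraph 1 A₂ in
  RadioNumberIs (T₁ □ T₂) (+ ((1 * 1 ∸ 1) * (diam T₁ + diam T₂ + 1)) - + (2 * 1 * totalLevel T₁) - + (2 * 1 * totalLevel T₂) ℤ.+ + 1)
    ⇔ Prod.GoodOrdering T₁ T₂
single-vertex A₁ A₂ = mk⇔
  (λ (_ , minimal) → case minimal (λ _ → 0) (λ where (zero , zero) (zero , zero) u≢v → ⊥-elim (u≢v refl)) of λ where (ℤ.+≤+ ()))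
  (λ (z , _ , _ , _ , (ends , _) , _) → ⊥-elim (no-ends (z 0) (ends refl)))
  where
  T₁ = finGraph 1 A₁
  T₂ = finGraph 1 A₂
  no-ends : ∀ v → Prod.Lz T₁ T₂ v + Prod.Lz T₁ T₂ v ≢ 1
  no-ends (zero , zero) ()

one-one : ∀ {m n A₁ A₂} (tree₁ : IsTree m A₁) (tree₂ : IsTree n A₂) →
  let T₁ = finGraph m A₁ ; T₂ = finGraph n A₂ in
  nW T₁ ≡ 1 → nW T₂ ≡ 1 →
  RadioNumberIs (T₁ □ T₂) (+ ((m * n ∸ 1) * (diam T₁ + diam T₂ + 1)) - + (2 * n * totalLevel T₁) - + (2 * m * totalLevel T₂) ℤ.+ + 1)
    ⇔ Prod.GoodOrdering T₁ T₂
one-one {m} {n} {A₁} {A₂} tree₁ tree₂ nW₁ nW₂ = by-order (Fin×Fin⇒*≡suc C₁.w C₂.w)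
  where
  module C₁ = FinTreeCenters.One m A₁ tree₁ nW₁
  module C₂ = FinTreeCenters.One n A₂ tree₂ nW₂
  T₁ = finGraph m A₁
  T₂ = finGraph n A₂
  open Prod T₁ T₂
  nWG≡1 : nWG ≡ 1
  nWG≡1 = cong₂ _*_ nW₁ nW₂
  ξ≡0 : ξ ≡ 0
  ξ≡0 = cong₂ (λ a b → a + b ∸ 2) nW₁ nW₂
  δ≤ξ : ∀ u v → δz u v ≤ ξ
  δ≤ξ (x , y) (x′ , y′) = subst (δz (x , y) (x′ , y′) ≤_) (sym ξ≡0) (+-mono-≤ (C₁.delta≤ x x′) (C₂.delta≤ y y′))
  central : ∀ v → Lz v ≡ 0 → v ≡ (C₁.w , C₂.w)
  central (x , y) eq = cong₂ _,_ (C₁.ℓ≡0⇒ (m+n≡0⇒m≡0 _ eq)) (C₂.ℓ≡0⇒ (m+n≡0⇒n≡0 (level T₁ x) eq))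
  by-order : ∃[ P ] m * n ≡ suc P → _
  -- With one vertex the two ends coincide at level 0, so e = 1 would not be a lower bound.
  by-order (zero , p≡) with m*n≡1⇒m≡1 m n p≡ | m*n≡1⇒n≡1 m n p≡
  ... | refl | refl = single-vertex A₁ A₂
  by-order (suc Q , p≡) = radioNumber⇔goodOrdering (value₁ ξ≡0) ends≥1 (Σδ≤-uniform δ≤ξ) (ends⇔1 nWG≡1)
      (λ _ → steps-uniform (λ eq → case trans (sym nWG≡1) eq of λ ()) δ≤ξ)
    where
    open RadioNumber tree₁ tree₂ C₁.dist-formula C₂.dist-formula (suc Q) p≡ (C₁.w , C₂.w)
    open Trees tree₁ tree₂ C₁.dist-formula C₂.dist-formula (suc Q) p≡ (C₁.w , C₂.w)
    -- The first and last vertex are distinct, and only one vertex has level 0.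
    ends≥1 : ∀ {z} → Enumerates (suc (suc Q)) z → 1 ≤ ends z
    ends≥1 {z} (_ , injective) = n≢0⇒n>0 λ eq → case injective 0 (suc Q) (s≤s z≤n) ≤-refl
      (trans (central _ (m+n≡0⇒m≡0 _ eq)) (sym (central _ (m+n≡0⇒n≡0 (Lz (z 0)) eq)))) of λ ()

one-two : ∀ {m n A₁ A₂} (tree₁ : IsTree m A₁) (tree₂ : IsTree n A₂) →
  let T₁ = finGraph m A₁ ; T₂ = finGraph n A₂ in
  nW T₁ * nW T₂ ≡ 2 →
  RadioNumberIs (T₁ □ T₂) (+ ((m * n ∸ 1) * (diam T₁ + diam T₂)) - + (2 * n * totalLevel T₁) - + (2 * m * totalLevel T₂))
    ⇔ Prod.GoodOrdering T₁ T₂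
one-two {m} {n} {A₁} {A₂} tree₁ tree₂ nWG≡2 = by-centers (*≡2 (nW T₁) (nW T₂) nWG≡2)
  where
  T₁ = finGraph m A₁
  T₂ = finGraph n A₂
  open Prod T₁ T₂
  uniform : Formula T₁ → Formula T₂ → Fin m × Fin n → ξ ≡ 1 → (∀ u v → δz u v ≤ 1) → _
  uniform formula₁ formula₂ x₀ ξ≡1 δ≤1 =
    radioNumber⇔goodOrdering (value₂ ξ≡1) (λ _ → z≤n) (Σδ≤-uniform δ≤ξ) (ends⇔0 (≤-reflexive (sym nWG≡2)))
      (λ _ → steps-uniform (λ eq → case trans (sym nWG≡2) eq of λ ()) δ≤ξ)
    where
    size = Fin×Fin⇒*≡suc (proj₁ x₀) (proj₂ x₀)
    open RadioNumber tree₁ tree₂ formula₁ formula₂ (proj₁ size) (proj₂ size) x₀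
    open Trees tree₁ tree₂ formula₁ formula₂ (proj₁ size) (proj₂ size) x₀
    δ≤ξ : ∀ u v → δz u v ≤ ξ
    δ≤ξ u v = subst (δz u v ≤_) (sym ξ≡1) (δ≤1 u v)
  by-centers : (nW T₁ ≡ 1 × nW T₂ ≡ 2) ⊎ (nW T₁ ≡ 2 × nW T₂ ≡ 1) → _
  by-centers (inj₁ (nW₁ , nW₂)) = uniform C₁.dist-formula C₂.dist-formula (C₁.w , C₂.w)
      (cong₂ (λ a b → a + b ∸ 2) nW₁ nW₂) (λ (x , y) (x′ , y′) → +-mono-≤ (C₁.delta≤ x x′) (C₂.delta≤ y y′))
    where
    module C₁ = FinTreeCenters.One m A₁ tree₁ nW₁
    module C₂ = FinTreeCenters.Two n A₂ tree₂ nW₂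
  by-centers (inj₂ (nW₁ , nW₂)) = uniform C₁.dist-formula C₂.dist-formula (C₁.w , C₂.w)
      (cong₂ (λ a b → a + b ∸ 2) nW₁ nW₂) (λ (x , y) (x′ , y′) → +-mono-≤ (C₁.delta≤ x x′) (C₂.delta≤ y y′))
    where
    module C₁ = FinTreeCenters.Two m A₁ tree₁ nW₁
    module C₂ = FinTreeCenters.One n A₂ tree₂ nW₂

two-two : ∀ {m n A₁ A₂} (tree₁ : IsTree m A₁) (tree₂ : IsTree n A₂) →
  let T₁ = finGraph m A₁ ; T₂ = finGraph n A₂ in
  nW T₁ ≡ 2 → nW T₂ ≡ 2 →
  RadioNumberIs (T₁ □ T₂) ((+ (m * n ∸ 1) ℤ.* (+ (diam T₁ + diam T₂) - + 1)) - + (2 * n * totalLevel T₁) - + (2 * m * totalLevel T₂) ℤ.+ + 1)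
    ⇔ Prod.GoodOrdering T₁ T₂
two-two {m} {n} {A₁} {A₂} tree₁ tree₂ nW₁ nW₂ =
  radioNumber⇔goodOrdering (value₃ (Δ+1 P p≡)) (λ _ → z≤n) (Σδ≤ P p≡) (ends⇔0 (≤-trans (s≤s (s≤s z≤n)) (≤-reflexive (sym nWG≡4)))) (steps⇔ P p≡)
  where
  open FourCenters tree₁ tree₂ nW₁ nW₂
  size = Fin×Fin⇒*≡suc (proj₁ x₀) (proj₂ x₀)
  P  = proj₁ size
  p≡ = proj₂ size
  module C₁ = FinTreeCenters.Two m A₁ tree₁ nW₁
  module C₂ = FinTreeCenters.Two n A₂ tree₂ nW₂
  open RadioNumber tree₁ tree₂ C₁.dist-formula C₂.dist-formula P p≡ x₀

theorem3p3 : (m n : ℕ) (A₁ : Fin m → Fin m → Bool) (A₂ : Fin n → Fin n → Bool) →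
    IsTree m A₁ → IsTree n A₂ →
    let T₁ = finGraph m A₁
        T₂ = finGraph n A₂
        G = T₁ □ T₂
        p = m * n
        d = diam T₁ + diam T₂
        L₁ = totalLevel T₁
        L₂ = totalLevel T₂
    in (nW T₁ ≡ 1 → nW T₂ ≡ 1 →
          (RadioNumberIs G (+ ((p ∸ 1) * (d + 1)) - + (2 * n * L₁) - + (2 * m * L₂) ℤ.+ + 1)
            ⇔ Prod.GoodOrdering T₁ T₂))
     × (nW T₁ * nW T₂ ≡ 2 →
          (RadioNumberIs G (+ ((p ∸ 1) * d) - + (2 * n * L₁) - + (2 * m * L₂))
            ⇔ Prod.GoodOrdering T₁ T₂))
     × (nW T₁ ≡ 2 → nW T₂ ≡ 2 →
          (RadioNumberIs G ((+ (p ∸ 1) ℤ.* (+ d - + 1)) - + (2 * n * L₁) - + (2 * m * L₂) ℤ.+ + 1)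
            ⇔ Prod.GoodOrdering T₁ T₂))
theorem3p3 m n A₁ A₂ tree₁ tree₂ =
  one-one tree₁ tree₂ , one-two tree₁ tree₂ , two-two tree₁ tree₂
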